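{- Let $T=(V,E)$ be a tree, let $V_c\subsetneq V$ with $|V_c|=3$, and let $g:V_c\to\{0,1\}$ be such that no two adjacent vertices of $V_c$ have the same value under $g$. Then any maximum contrast greyscale $f$ for the $\{0,1\}$-restricted maximum contrast problem on $T$ with initial colouring $g$ satisfies $|\{v\in V : f(v)=\frac12\}|\le 2$.
   Context: Graphs are finite, undirected and simple. A greyscale of a graph $G=(V,E)$ is a map $f:V\to[0,1]$ with $0,1\in \mathrm{Im}(f)$. For $e=\{u,v\}\in E$ put $\widehat f(e)=|f(u)-f(v)|$. The contrast vector $\mathcal C_f$ is the vector of all values $\widehat f(e)$, $e\in E$, listed in ascending order; contrast vectors are compared lexicographically. A greyscale $f$ is compatible with $g$ if $f(u)=g(u)$ for all $u\in V_c$. A maximum contrast greyscale for the $\{0,1\}$-restricted maximum contrast problem ($\{0,1\}$-RMACG) with data $(G,V_c,g)$ is a greyscale compatible with $g$ whose contrast vector is the lexicographic maximum among all greyscales of $G$ compatible with $g$. -}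

module Defs where

open import Data.Fin using (Fin; zero; suc)
import Data.Fin as Fin
open import Data.Fin.Subset using (Subset; _∈_; ∣_∣)
open import Data.List using (List; []; _∷_; _++_; map; filter; length; allFin; cartesianProduct)
open import Data.List.Relation.Binary.Lex.Strict using (Lex-<)
open import Data.List.Relation.Binary.Permutation.Propositional using (_↭_)
open import Data.List.Relation.Unary.Linked using (Linked)
open import Data.List.Relation.Unary.Unique.Propositional using (Unique)
open import Data.Nat using (ℕ)
import Data.Nat as ℕ
import Data.Nat.Properties as ℕₚ
open import Data.Product using (∃-syntax; _×_; _,_)
open import Data.Rational using (ℚ; 0ℚ; 1ℚ; ½)
import Data.Rational as ℚ
import Data.Rational.Properties as ℚₚ
open import Data.Rational.Solver using (module +-*-Solver)
open import Data.Sum using (inj₁; inj₂)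
open import Relation.Binary.Construct.Closure.ReflexiveTransitive using (Star)
open import Relation.Binary.PropositionalEquality using (_≡_; refl; sym; cong; subst)
open import Relation.Nullary using (¬_; Dec)
open import Relation.Nullary.Decidable using (_×-dec_)

------------------------------------------------------------------------
-- Real numbers: Cauchy sequences of rationals, with _≈_ as equality.

IsCauchy : (ℕ → ℚ) → Set
IsCauchy x = ∀ ε → 0ℚ ℚ.< ε →
  ∃[ N ] (∀ m n → N ℕ.≤ m → N ℕ.≤ n → ℚ.∣ x m ℚ.- x n ∣ ℚ.< ε)

record ℝ : Set where
  constructor mkℝ
  field
    seq    : ℕ → ℚ
    cauchy : IsCauchy seq

open ℝ public

infix 4 _≈_ _<_ _≤_
infixl 6 _-_

_≈_ : ℝ → ℝ → Set
x ≈ y = ∀ ε → 0ℚ ℚ.< ε →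
  ∃[ N ] (∀ n → N ℕ.≤ n → ℚ.∣ seq x n ℚ.- seq y n ∣ ℚ.< ε)

_<_ : ℝ → ℝ → Set
x < y = ∃[ ε ] (0ℚ ℚ.< ε × ∃[ N ] (∀ n → N ℕ.≤ n → seq x n ℚ.+ ε ℚ.≤ seq y n))

_≤_ : ℝ → ℝ → Set
x ≤ y = ¬ (y < x)

fromℚ : ℚ → ℝ
fromℚ q = mkℝ (λ _ → q) λ ε 0<ε → 0 , λ _ _ _ _ →
  subst (ℚ._< ε) (sym (cong ℚ.∣_∣ (ℚₚ.+-inverseʳ q))) 0<ε

0ℝ 1ℝ ½ℝ : ℝ
0ℝ = fromℚ 0ℚ
1ℝ = fromℚ 1ℚ
½ℝ = fromℚ ½

private
  0<½* : ∀ ε → 0ℚ ℚ.< ε → 0ℚ ℚ.< ½ ℚ.* ε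
  0<½* ε 0<ε =
    subst (ℚ._< ½ ℚ.* ε) (ℚₚ.*-zeroʳ ½) (ℚₚ.*-monoʳ-<-pos ½ 0<ε)

  ½*+½* : ∀ ε → ½ ℚ.* ε ℚ.+ ½ ℚ.* ε ≡ ε
  ½*+½* = solve 1 (λ ε → con ½ :* ε :+ con ½ :* ε := ε) refl
    where open +-*-Solver

  sub-interchange : ∀ a b c d →
    (a ℚ.- b) ℚ.- (c ℚ.- d) ≡ (a ℚ.- c) ℚ.- (b ℚ.- d)
  sub-interchange =
    solve 4 (λ a b c d → (a :- b) :- (c :- d) := (a :- c) :- (b :- d)) refl
    where open +-*-Solver

  ∣a∣-∣c∣≤∣a-c∣ : ∀ a c → ℚ.∣ a ∣ ℚ.- ℚ.∣ c ∣ ℚ.≤ ℚ.∣ a ℚ.- c ∣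
  ∣a∣-∣c∣≤∣a-c∣ a c = begin
    ℚ.∣ a ∣ ℚ.- ℚ.∣ c ∣
      ≡⟨ cong (λ z → ℚ.∣ z ∣ ℚ.- ℚ.∣ c ∣) (split a c) ⟩
    ℚ.∣ (a ℚ.- c) ℚ.+ c ∣ ℚ.- ℚ.∣ c ∣
      ≤⟨ ℚₚ.+-monoˡ-≤ (ℚ.- ℚ.∣ c ∣) (ℚₚ.∣p+q∣≤∣p∣+∣q∣ (a ℚ.- c) c) ⟩
    (ℚ.∣ a ℚ.- c ∣ ℚ.+ ℚ.∣ c ∣) ℚ.- ℚ.∣ c ∣
      ≡⟨ cancel ℚ.∣ a ℚ.- c ∣ ℚ.∣ c ∣ ⟩
    ℚ.∣ a ℚ.- c ∣ ∎
    where
    open ℚₚ.≤-Reasoning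
    open +-*-Solver
    split : ∀ a c → a ≡ (a ℚ.- c) ℚ.+ c
    split = solve 2 (λ a c → a := (a :- c) :+ c) refl
    cancel : ∀ a c → (a ℚ.+ c) ℚ.- c ≡ a
    cancel = solve 2 (λ a c → (a :+ c) :- c := a) refl

  neg-sub : ∀ a c → ℚ.- (a ℚ.- c) ≡ c ℚ.- a
  neg-sub = solve 2 (λ a c → :- (a :- c) := c :- a) refl
    where open +-*-Solver

  ∣∣a∣-∣c∣∣≤∣a-c∣ : ∀ a c → ℚ.∣ ℚ.∣ a ∣ ℚ.- ℚ.∣ c ∣ ∣ ℚ.≤ ℚ.∣ a ℚ.- c ∣
  ∣∣a∣-∣c∣∣≤∣a-c∣ a c with ℚₚ.∣p∣≡p∨∣p∣≡-p (ℚ.∣ a ∣ ℚ.- ℚ.∣ c ∣)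
  ... | inj₁ eq = subst (ℚ._≤ ℚ.∣ a ℚ.- c ∣) (sym eq) (∣a∣-∣c∣≤∣a-c∣ a c)
  ... | inj₂ eq = begin
    ℚ.∣ ℚ.∣ a ∣ ℚ.- ℚ.∣ c ∣ ∣  ≡⟨ eq ⟩
    ℚ.- (ℚ.∣ a ∣ ℚ.- ℚ.∣ c ∣)  ≡⟨ neg-sub ℚ.∣ a ∣ ℚ.∣ c ∣ ⟩
    ℚ.∣ c ∣ ℚ.- ℚ.∣ a ∣        ≤⟨ ∣a∣-∣c∣≤∣a-c∣ c a ⟩
    ℚ.∣ c ℚ.- a ∣              ≡⟨ cong ℚ.∣_∣ (neg-sub a c) ⟨
    ℚ.∣ ℚ.- (a ℚ.- c) ∣        ≡⟨ ℚₚ.∣-p∣≡∣p∣ (a ℚ.- c) ⟩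
    ℚ.∣ a ℚ.- c ∣              ∎
    where open ℚₚ.≤-Reasoning

_-_ : ℝ → ℝ → ℝ
x - y = mkℝ (λ n → seq x n ℚ.- seq y n) λ ε 0<ε →
  let (M , x-close) = cauchy x (½ ℚ.* ε) (0<½* ε 0<ε)
      (N , y-close) = cauchy y (½ ℚ.* ε) (0<½* ε 0<ε)
  in M ℕ.⊔ N , λ m n M⊔N≤m M⊔N≤n →
    let a = seq x m; b = seq y m; c = seq x n; d = seq y n
        open ℚₚ.≤-Reasoning
    in begin-strict
      ℚ.∣ (a ℚ.- b) ℚ.- (c ℚ.- d) ∣
        ≡⟨ cong ℚ.∣_∣ (sub-interchange a b c d) ⟩
      ℚ.∣ (a ℚ.- c) ℚ.- (b ℚ.- d) ∣
        ≤⟨ ℚₚ.∣p-q∣≤∣p∣+∣q∣ (a ℚ.- c) (b ℚ.- d) ⟩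
      ℚ.∣ a ℚ.- c ∣ ℚ.+ ℚ.∣ b ℚ.- d ∣
        <⟨ ℚₚ.+-mono-<
             (x-close m n (ℕₚ.m⊔n≤o⇒m≤o M N M⊔N≤m) (ℕₚ.m⊔n≤o⇒m≤o M N M⊔N≤n))
             (y-close m n (ℕₚ.m⊔n≤o⇒n≤o M N M⊔N≤m) (ℕₚ.m⊔n≤o⇒n≤o M N M⊔N≤n)) ⟩
      ½ ℚ.* ε ℚ.+ ½ ℚ.* ε
        ≡⟨ ½*+½* ε ⟩
      ε ∎

abs : ℝ → ℝ
abs x = mkℝ (λ n → ℚ.∣ seq x n ∣) λ ε 0<ε →
  let (N , x-close) = cauchy x ε 0<ε
  in N , λ m n N≤m N≤n →
    ℚₚ.≤-<-trans (∣∣a∣-∣c∣∣≤∣a-c∣ (seq x m) (seq x n)) (x-close m n N≤m N≤n)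

------------------------------------------------------------------------
-- Graphs

record Graph (n : ℕ) : Set₁ where
  field
    Adj     : Fin n → Fin n → Set
    adj?    : ∀ u v → Dec (Adj u v)
    adj-sym : ∀ {u v} → Adj u v → Adj v u
    irrefl  : ∀ {v} → ¬ Adj v v

  -- Each edge {u,v} occurs exactly once, as the pair with u < v.
  edges : List (Fin n × Fin n)
  edges = filter (λ (u , v) → (u Fin.<? v) ×-dec adj? u v)
                 (cartesianProduct (allFin n) (allFin n))

  Connected : Set
  Connected = ∀ u v → Star Adj u v

  IsCycle : Fin n → List (Fin n) → Set
  IsCycle v vs = 2 ℕ.≤ length vs × Unique (v ∷ vs) × Linked Adj (v ∷ vs ++ v ∷ [])

  Acyclic : Set
  Acyclic = ∀ v vs → ¬ IsCycle v vs

  IsTree : Set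
  IsTree = Connected × Acyclic

open Graph public using (Adj; IsTree)

------------------------------------------------------------------------
-- Greyscales and contrast vectors

record IsGreyscale {n} (f : Fin n → ℝ) : Set where
  field
    lower : ∀ v → 0ℝ ≤ f v
    upper : ∀ v → f v ≤ 1ℝ
    hits0 : ∃[ v ] f v ≈ 0ℝ
    hits1 : ∃[ v ] f v ≈ 1ℝ

contrast : ∀ {n} → (Fin n → ℝ) → Fin n × Fin n → ℝ
contrast f (u , v) = abs (f u - f v)

-- The order on ℝ is not decidable, so the ascending listing of the edge
-- contrasts is specified by a relation rather than computed by sorting.
-- It is determined by f up to entrywise _≈_.
IsContrastVector : ∀ {n} → Graph n → (Fin n → ℝ) → List ℝ → Set
IsContrastVector G f c = c ↭ map (contrast f) (Graph.edges G) × Linked _≤_ c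

infix 4 _<ₗₑₓ_ _≤ₗₑₓ_

_<ₗₑₓ_ : List ℝ → List ℝ → Set
_<ₗₑₓ_ = Lex-< _≈_ _<_

_≤ₗₑₓ_ : List ℝ → List ℝ → Set
c ≤ₗₑₓ d = ¬ (d <ₗₑₓ c)

-- The values of an initial colouring are 0, 1 ∈ Fin 2.
colour : Fin 2 → ℝ
colour zero       = 0ℝ
colour (suc zero) = 1ℝ

Colouring : ∀ {n} → Subset n → Set
Colouring Vc = ∀ v → v ∈ Vc → Fin 2

record IsCompatibleGreyscale {n} (Vc : Subset n) (g : Colouring Vc)
                             (f : Fin n → ℝ) : Set where
  field
    greyscale  : IsGreyscale f
    compatible : ∀ v (v∈Vc : v ∈ Vc) → f v ≈ colour (g v v∈Vc)

record IsMaximumContrastGreyscale {n} (G : Graph n) (Vc : Subset n) (g : Colouring Vc)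
                                  (f : Fin n → ℝ) : Set where
  field
    isCompatibleGreyscale : IsCompatibleGreyscale Vc g f
    maximum : ∀ h → IsCompatibleGreyscale Vc g h →
              ∀ c d → IsContrastVector G f c → IsContrastVector G h d → d ≤ₗₑₓ c

-- |{v : P v}| ≤ k for P not necessarily decidable: every finite set of
-- vertices satisfying P has at most k elements.
CardAtMost : ∀ {n} → ℕ → (Fin n → Set) → Set
CardAtMost {n} k P = ∀ (S : Subset n) → (∀ v → v ∈ S → P v) → ∣ S ∣ ℕ.≤ k

{-# OPTIONS --safe #-}

-- If g agrees with a proper 2-colouring of T, that colouring has all contrasts 1, so f has too
-- and never takes the value ½. Otherwise one vertex a of Vc is out of phase with the other two, b
-- and c. Shading the neighbours of a with ½, and using the two opposite proper colourings at a
-- and beyond, gives contrasts ≥ ½, so all contrasts of f are ≥ ½. Hence f crosses ½ along every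
-- edge with no end at ½, so the phase can only change at a ½-vertex: the paths from a to b and
-- from a to c contain vertices h₁ and h₂ with f = ½. Shading only h₁ and h₂ with ½, and using one
-- proper colouring on the component of a in T − {h₁, h₂} and the opposite one elsewhere, gives a
-- greyscale that dominates f on every edge, strictly on the edges at any further ½-vertex.
--
-- The order on ℝ is undecidable; since the conclusion is decidable, everything is argued under ¬¬.

module Submission where

open import Defs
open import Data.Nat using (ℕ)
open import Data.Fin using (Fin)
open import Data.Fin.Subset using (Subset; _∈_; _⊂_; ⊤; ∣_∣)
open import Relation.Binary.PropositionalEquality using (_≡_; _≢_)
open import Data.Bool using (Bool; true; false; not; _xor_; if_then_else_)
import Data.Bool as Bool
open import Data.Bool.Properties
  using (not-involutive; not-distribˡ-xor; not-distribʳ-xor; xor-assoc; xor-same; not-¬; ¬-not)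
open import Data.Empty using (⊥)
import Data.Fin as Fin
import Data.Fin.Properties as Finₚ
open import Data.Fin.Subset using (⁅_⁆; _∪_; _⊆_)
open import Data.Fin.Subset.Properties using (p⊆q⇒∣p∣≤∣q∣; ∣⁅x⁆∣≡1; x∈⁅x⁆; x∈p∪q⁺)
open import Data.List using (List; []; _∷_; _++_; map; length; allFin; cartesianProduct)
import Data.List.Membership.Propositional as List
open import Data.List.Membership.Propositional.Properties
  using (∈-map⁺; ∈-map⁻; ∈-∃++; ∈-filter⁺; ∈-filter⁻; ∈-cartesianProduct⁺; ∈-allFin)
open import Data.List.Properties using (map-∘; length-map)
open import Data.List.Relation.Binary.Lex.Core using (this; next)
open import Data.List.Relation.Binary.Permutation.Propositional
  using (_↭_; ↭-refl; ↭-trans; ↭-sym; prep; swap)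
open import Data.List.Relation.Binary.Permutation.Propositional.Properties
  using (All-resp-↭; Any-resp-↭; ∈-resp-↭; shift; drop-∷)
import Data.List.Relation.Binary.Permutation.Propositional.Properties as Perm
open import Data.List.Relation.Unary.All as All using (All; []; _∷_)
import Data.List.Relation.Unary.All.Properties as Allₚ
open import Data.List.Relation.Unary.AllPairs using (AllPairs; []; _∷_)
import Data.List.Relation.Unary.AllPairs.Properties as AllPairsₚ
open import Data.List.Relation.Unary.Any using (Any; here; there)
import Data.List.Relation.Unary.Any.Properties as Anyₚ
open import Data.List.Relation.Unary.Linked using (Linked; []; [-]; _∷_)
open import Data.List.Relation.Unary.Linked.Properties using (AllPairs⇒Linked)
open import Data.List.Relation.Unary.Unique.Propositional using (Unique)
open import Data.Nat using (zero; suc)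
import Data.Nat as ℕ
import Data.Nat.Properties as ℕₚ
open import Data.Product using (∃-syntax; _×_; _,_; proj₁; proj₂; map₂)
open import Data.Rational using (ℚ; 0ℚ; 1ℚ; ½)
import Data.Rational as ℚ
import Data.Rational.Properties as ℚₚ
open import Data.Rational.Solver using (module +-*-Solver)
open import Data.Sum using (_⊎_; inj₁; inj₂; [_,_]′)
open import Data.Vec using ([]; _∷_)
import Data.Vec as Vec
open import Data.Vec.Properties.WithK using ([]=-irrelevant)
open import Effect.Monad using (RawMonad)
open import Function using (id; _∘_; _$_)
open import Relation.Binary.Construct.Closure.ReflexiveTransitive as Star using (Star; _◅_)
open import Relation.Binary.Definitions using (tri<; tri≈; tri>)
open import Relation.Binary.PropositionalEquality
  using (refl; sym; trans; cong; cong₂; subst; subst₂; module ≡-Reasoning)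
open import Relation.Nullary
  using (¬_; Dec; yes; no; does; contradiction; ¬¬-excluded-middle; decidable-stable;
         ¬?; _×-dec_; _⊎-dec_)
open import Relation.Nullary.Negation using (¬¬-Monad)

-- Order and arithmetic of Cauchy reals

0<*½ : ∀ {ε} → 0ℚ ℚ.< ε → 0ℚ ℚ.< ½ ℚ.* ε
0<*½ {ε} 0<ε = subst (ℚ._< ½ ℚ.* ε) (ℚₚ.*-zeroʳ ½) (ℚₚ.*-monoʳ-<-pos ½ 0<ε)

-- Reduces a rational inequality to a known one and a ring identity between the differences, which
-- the solver can check.
shift-< : ∀ {a b c d} → a ℚ.< b → d ℚ.- c ≡ b ℚ.- a → c ℚ.< d
shift-< {a} {b} {c} {d} a<b eq = subst₂ ℚ._<_
  (solve 2 (λ a c → a :+ (c :- a) := c) refl a c)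
  (trans (solve 3 (λ a b c → b :+ (c :- a) := (b :- a) :+ c) refl a b c)
    (trans (cong (ℚ._+ c) (sym eq)) (solve 2 (λ c d → (d :- c) :+ c := d) refl c d)))
  (ℚₚ.+-monoˡ-< (c ℚ.- a) a<b)
  where open +-*-Solver

shift-≤ : ∀ {a b c d} → a ℚ.≤ b → d ℚ.- c ≡ b ℚ.- a → c ℚ.≤ d
shift-≤ {a} {b} {c} {d} a≤b eq = subst₂ ℚ._≤_
  (solve 2 (λ a c → a :+ (c :- a) := c) refl a c)
  (trans (solve 3 (λ a b c → b :+ (c :- a) := (b :- a) :+ c) refl a b c)
    (trans (cong (ℚ._+ c) (sym eq)) (solve 2 (λ c d → (d :- c) :+ c := d) refl c d)))
  (ℚₚ.+-monoˡ-≤ (c ℚ.- a) a≤b)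
  where open +-*-Solver

p≤∣p∣ : ∀ p → p ℚ.≤ ℚ.∣ p ∣
p≤∣p∣ p with ℚₚ.≤-total 0ℚ p
... | inj₁ 0≤p = ℚₚ.≤-reflexive (sym (ℚₚ.0≤p⇒∣p∣≡p 0≤p))
... | inj₂ p≤0 = ℚₚ.≤-trans p≤0 (ℚₚ.0≤∣p∣ p)

∣p∣<q : ∀ {p q} → p ℚ.< q → ℚ.- p ℚ.< q → ℚ.∣ p ∣ ℚ.< q
∣p∣<q {p} {q} p<q -p<q with ℚₚ.∣p∣≡p∨∣p∣≡-p p
... | inj₁ eq = subst (ℚ._< q) (sym eq) p<q
... | inj₂ eq = subst (ℚ._< q) (sym eq) -p<q

∣p∣≤q : ∀ {p q} → p ℚ.≤ q → ℚ.- p ℚ.≤ q → ℚ.∣ p ∣ ℚ.≤ q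
∣p∣≤q {p} {q} p≤q -p≤q with ℚₚ.∣p∣≡p∨∣p∣≡-p p
... | inj₁ eq = subst (ℚ._≤ q) (sym eq) p≤q
... | inj₂ eq = subst (ℚ._≤ q) (sym eq) -p≤q

Eventually : (ℕ → Set) → Set
Eventually P = ∃[ N ] (∀ n → N ℕ.≤ n → P n)

eventually₂ : ∀ {P Q R : ℕ → Set} → (∀ n → P n → Q n → R n) →
              Eventually P → Eventually Q → Eventually R
eventually₂ k (M , p) (N , q) = M ℕ.⊔ N , λ n le →
  k n (p n (ℕₚ.m⊔n≤o⇒m≤o M N le)) (q n (ℕₚ.m⊔n≤o⇒n≤o M N le))

¬eventually-⊥ : ¬ Eventually (λ _ → ⊥)
¬eventually-⊥ (N , p) = p N ℕₚ.≤-refl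

-- A constructive substitute for deciding `x < y`: beyond some index `N` the difference `y - x`
-- hardly moves, so one rational comparison at `N` selects the alternative.
<-or-eventually : ∀ x y {ε} → 0ℚ ℚ.< ε →
  x < y ⊎ Eventually (λ n → seq y n ℚ.< seq x n ℚ.+ ε)
<-or-eventually x y {ε} 0<ε = located (cauchy (y - x) δ 0<δ)
  where
  open +-*-Solver
  -- A quarter of ε: if `z N` is at least 2δ, a drift below δ leaves a gap of δ; otherwise every
  -- later `z n` is below 3δ, hence below ε.
  δ = ½ ℚ.* (½ ℚ.* ε)
  0<δ : 0ℚ ℚ.< δ
  0<δ = 0<*½ (0<*½ 0<ε)
  z : ℕ → ℚ
  z n = seq y n ℚ.- seq x n
  CloseFrom : ℕ → Set
  CloseFrom N = ∀ m n → N ℕ.≤ m → N ℕ.≤ n → ℚ.∣ z m ℚ.- z n ∣ ℚ.< δ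
  decide : ∀ N → CloseFrom N → Dec (δ ℚ.+ δ ℚ.≤ z N) →
           x < y ⊎ Eventually (λ n → seq y n ℚ.< seq x n ℚ.+ ε)
  decide N close (yes p) = inj₁ (δ , 0<δ , N , λ n N≤n → ℚₚ.<⇒≤
    (shift-< (ℚₚ.+-mono-<-≤ (ℚₚ.≤-<-trans (p≤∣p∣ _) (close N n ℕₚ.≤-refl N≤n)) p)
      (solve 4 (λ a b d w → b :- (a :+ d) := (d :+ w) :- ((w :- (b :- a)) :+ (d :+ d)))
        refl (seq x n) (seq y n) δ (z N))))
  decide N close (no ¬p) = inj₂ (N , λ n N≤n →
    shift-< (ℚₚ.+-mono-< (ℚₚ.≤-<-trans (p≤∣p∣ _) (close n N N≤n ℕₚ.≤-refl))
                         (ℚₚ.+-mono-< (ℚₚ.≰⇒> ¬p) 0<δ))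
      (solve 4 (λ a b e w → let d = con ½ :* (con ½ :* e) in
          (a :+ e) :- b := (d :+ ((d :+ d) :+ d)) :- (((b :- a) :- w) :+ (w :+ con 0ℚ)))
        refl (seq x n) (seq y n) ε (z N)))
  located : ∃[ N ] CloseFrom N → x < y ⊎ Eventually (λ n → seq y n ℚ.< seq x n ℚ.+ ε)
  located (N , close) = decide N close ((δ ℚ.+ δ) ℚₚ.≤? z N)

≤⇒eventually : ∀ x y → x ≤ y → ∀ {ε} → 0ℚ ℚ.< ε →
               Eventually (λ n → seq x n ℚ.< seq y n ℚ.+ ε)
≤⇒eventually x y x≤y 0<ε =
  [ (λ y<x → contradiction y<x x≤y) , id ]′ (<-or-eventually y x 0<ε)

eventually⇒≤ : ∀ x y →
  (∀ {ε} → 0ℚ ℚ.< ε → Eventually (λ n → seq x n ℚ.< seq y n ℚ.+ ε)) → x ≤ y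
eventually⇒≤ x y ev (ε , 0<ε , gap) =
  ¬eventually-⊥ (eventually₂ (λ _ p q → ℚₚ.<-irrefl refl (ℚₚ.<-≤-trans p q)) (ev 0<ε) gap)

-- Compare `y` with `z` up to half the gap between `x` and `z`; if `y < z` is not found, the other
-- half of the gap separates `x` from `y`. The transitivity laws below are derived from this.
<-cotrans : ∀ x y z → x < z → x < y ⊎ y < z
<-cotrans x y z (ε , 0<ε , gap) = [ inj₂ , (λ ev → inj₁ (½ ℚ.* ε , 0<*½ 0<ε , eventually₂
  (λ n p q → ℚₚ.<⇒≤ (shift-< (ℚₚ.+-mono-≤-< p q)
    (solve 4 (λ a b c e → b :- (a :+ con ½ :* e)
        := (c :+ (b :+ con ½ :* e)) :- ((a :+ e) :+ c))
      refl (seq x n) (seq y n) (seq z n) ε))) gap ev)) ]′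
  (<-or-eventually y z (0<*½ 0<ε))
  where open +-*-Solver

<⇒≤ : ∀ x y → x < y → x ≤ y
<⇒≤ x y (ε , 0<ε , gap) (δ , 0<δ , gap′) = ¬eventually-⊥ (eventually₂
  (λ n p q → ℚₚ.<-irrefl refl (ℚₚ.<-≤-trans (ℚₚ.+-mono-< 0<ε 0<δ) (shift-≤ (ℚₚ.+-mono-≤ p q)
    (solve 4 (λ a b d e → (con 0ℚ :+ con 0ℚ) :- (e :+ d)
        := (b :+ a) :- ((a :+ e) :+ (b :+ d)))
      refl (seq x n) (seq y n) δ ε)))) gap gap′)
  where open +-*-Solver

≤-refl : ∀ x → x ≤ x
≤-refl x x<x = <⇒≤ x x x<x x<x

≤-trans : ∀ x y z → x ≤ y → y ≤ z → x ≤ z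
≤-trans x y z x≤y y≤z z<x = [ y≤z , x≤y ]′ (<-cotrans z y x z<x)

<-≤-trans : ∀ x y z → x < y → y ≤ z → x < z
<-≤-trans x y z x<y y≤z =
  [ id , (λ z<y → contradiction z<y y≤z) ]′ (<-cotrans x z y x<y)

≤-<-trans : ∀ x y z → x ≤ y → y < z → x < z
≤-<-trans x y z x≤y y<z =
  [ (λ y<x → contradiction y<x x≤y) , id ]′ (<-cotrans y x z y<z)

≈⇒≤ : ∀ x y → x ≈ y → x ≤ y
≈⇒≤ x y x≈y = eventually⇒≤ x y λ {ε} 0<ε → map₂ (λ k n N≤n →
  shift-< (ℚₚ.≤-<-trans (p≤∣p∣ _) (k n N≤n))
    (solve 3 (λ a b e → (b :+ e) :- a := e :- (a :- b)) refl (seq x n) (seq y n) ε))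
  (x≈y ε 0<ε)
  where open +-*-Solver

≈-sym : ∀ x y → x ≈ y → y ≈ x
≈-sym x y x≈y ε 0<ε = map₂ (λ k n N≤n → subst (ℚ._< ε)
  (trans (sym (ℚₚ.∣-p∣≡∣p∣ (seq x n ℚ.- seq y n)))
    (cong ℚ.∣_∣ (solve 2 (λ a b → :- (a :- b) := b :- a) refl (seq x n) (seq y n))))
  (k n N≤n)) (x≈y ε 0<ε)
  where open +-*-Solver

≈⇒≥ : ∀ x y → x ≈ y → y ≤ x
≈⇒≥ x y x≈y = ≈⇒≤ y x (≈-sym x y x≈y)

≤-antisym : ∀ x y → x ≤ y → y ≤ x → x ≈ y
≤-antisym x y x≤y y≤x ε 0<ε = eventually₂
  (λ n p q → ∣p∣<q
    (shift-< p (solve 3 (λ a b e → e :- (a :- b) := (b :+ e) :- a) refl (seq x n) (seq y n) ε))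
    (shift-< q (solve 3 (λ a b e → e :- (:- (a :- b)) := (a :+ e) :- b) refl
      (seq x n) (seq y n) ε)))
  (≤⇒eventually x y x≤y 0<ε) (≤⇒eventually y x y≤x 0<ε)
  where open +-*-Solver

≡⇒≈ : ∀ x y → (∀ n → seq x n ≡ seq y n) → x ≈ y
≡⇒≈ x y eq ε 0<ε = 0 , λ n _ → subst (ℚ._< ε)
  (sym (cong ℚ.∣_∣ (trans (cong (ℚ._- seq y n) (eq n)) (ℚₚ.+-inverseʳ (seq y n))))) 0<ε

fromℚ-mono-< : ∀ {p q} → p ℚ.< q → fromℚ p < fromℚ q
fromℚ-mono-< {p} {q} p<q = q ℚ.- p
  , shift-< p<q (solve 2 (λ p q → (q :- p) :- con 0ℚ := q :- p) refl p q)
  , 0 , λ _ _ → ℚₚ.≤-reflexive (solve 2 (λ p q → p :+ (q :- p) := q) refl p q)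
  where open +-*-Solver

sub-mono-≤ : ∀ x y p q → x ≤ p → q ≤ y → x - y ≤ p - q
sub-mono-≤ x y p q x≤p q≤y = eventually⇒≤ (x - y) (p - q) λ {ε} 0<ε → eventually₂
  (λ n r s → shift-< (ℚₚ.+-mono-< r s)
    (solve 5 (λ x y p q e → ((p :- q) :+ e) :- (x :- y)
        := ((p :+ con ½ :* e) :+ (y :+ con ½ :* e)) :- (x :+ q))
      refl (seq x n) (seq y n) (seq p n) (seq q n) ε))
  (≤⇒eventually x p x≤p (0<*½ 0<ε)) (≤⇒eventually q y q≤y (0<*½ 0<ε))
  where open +-*-Solver

sub-mono-<-≤ : ∀ x y p q → x < p → q ≤ y → x - y < p - q
sub-mono-<-≤ x y p q (ε , 0<ε , gap) q≤y = ½ ℚ.* ε , 0<*½ 0<ε , eventually₂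
  (λ n r s → ℚₚ.<⇒≤ (shift-< (ℚₚ.+-mono-≤-< r s)
    (solve 5 (λ x y p q e → (p :- q) :- ((x :- y) :+ con ½ :* e)
        := (p :+ (y :+ con ½ :* e)) :- ((x :+ e) :+ q))
      refl (seq x n) (seq y n) (seq p n) (seq q n) ε)))
  gap (≤⇒eventually q y q≤y (0<*½ 0<ε))
  where open +-*-Solver

sub-mono-≤-< : ∀ x y p q → x ≤ p → q < y → x - y < p - q
sub-mono-≤-< x y p q x≤p (ε , 0<ε , gap) = ½ ℚ.* ε , 0<*½ 0<ε , eventually₂
  (λ n r s → ℚₚ.<⇒≤ (shift-< (ℚₚ.+-mono-≤-< r s)
    (solve 5 (λ x y p q e → (p :- q) :- ((x :- y) :+ con ½ :* e)
        := (y :+ (p :+ con ½ :* e)) :- ((q :+ e) :+ x))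
      refl (seq x n) (seq y n) (seq p n) (seq q n) ε)))
  gap (≤⇒eventually x p x≤p (0<*½ 0<ε))
  where open +-*-Solver

abs-lub-≤ : ∀ x y z → x - y ≤ z → y - x ≤ z → abs (x - y) ≤ z
abs-lub-≤ x y z x-y≤z y-x≤z = eventually⇒≤ (abs (x - y)) z λ {ε} 0<ε → eventually₂
  (λ n p q → ∣p∣<q p (subst (ℚ._< seq z n ℚ.+ ε)
    (solve 2 (λ a b → b :- a := :- (a :- b)) refl (seq x n) (seq y n)) q))
  (≤⇒eventually (x - y) z x-y≤z 0<ε) (≤⇒eventually (y - x) z y-x≤z 0<ε)
  where open +-*-Solver

abs-lub-< : ∀ x y z → x - y < z → y - x < z → abs (x - y) < z
-- One gap has to serve both signs of `x - y`, hence the minimum of the two.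
abs-lub-< x y z (δ , 0<δ , gap) (ε , 0<ε , gap′) = δ ℚ.⊓ ε , 0<δ⊓ε , eventually₂
  (λ n p q → shift-≤ {b = seq z n ℚ.- (δ ℚ.⊓ ε)}
    (∣p∣≤q
      (shift-≤ (ℚₚ.+-mono-≤ p (ℚₚ.p⊓q≤p δ ε))
        (solve 5 (λ x y z d m → (z :- m) :- (x :- y) := (z :+ d) :- (((x :- y) :+ d) :+ m))
          refl (seq x n) (seq y n) (seq z n) δ (δ ℚ.⊓ ε)))
      (shift-≤ (ℚₚ.+-mono-≤ q (ℚₚ.p⊓q≤q δ ε))
        (solve 5 (λ x y z e m → (z :- m) :- (:- (x :- y)) := (z :+ e) :- (((y :- x) :+ e) :+ m))
          refl (seq x n) (seq y n) (seq z n) ε (δ ℚ.⊓ ε))))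
    (solve 3 (λ a z m → z :- (a :+ m) := (z :- m) :- a) refl
      ℚ.∣ seq x n ℚ.- seq y n ∣ (seq z n) (δ ℚ.⊓ ε)))
  gap gap′
  where
  open +-*-Solver
  0<δ⊓ε : 0ℚ ℚ.< δ ℚ.⊓ ε
  0<δ⊓ε with ℚₚ.⊓-sel δ ε
  ... | inj₁ eq = subst (0ℚ ℚ.<_) (sym eq) 0<δ
  ... | inj₂ eq = subst (0ℚ ℚ.<_) (sym eq) 0<ε

-- Contrasts, sorting and the lexicographic order

abs-sub-≤ : ∀ x y p q p′ q′ r → x ≤ fromℚ p → fromℚ q ≤ y → y ≤ fromℚ p′ → fromℚ q′ ≤ x →
            p ℚ.- q ≡ r → p′ ℚ.- q′ ≡ r → abs (x - y) ≤ fromℚ r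
abs-sub-≤ x y p q p′ q′ r x≤p q≤y y≤p′ q′≤x refl eq = abs-lub-≤ x y (fromℚ r)
  (≤-trans (x - y) (fromℚ p - fromℚ q) (fromℚ r)
    (sub-mono-≤ x y (fromℚ p) (fromℚ q) x≤p q≤y)
    (≈⇒≤ (fromℚ p - fromℚ q) (fromℚ r) (≡⇒≈ (fromℚ p - fromℚ q) (fromℚ r) λ _ → refl)))
  (≤-trans (y - x) (fromℚ p′ - fromℚ q′) (fromℚ r)
    (sub-mono-≤ y x (fromℚ p′) (fromℚ q′) y≤p′ q′≤x)
    (≈⇒≤ (fromℚ p′ - fromℚ q′) (fromℚ r) (≡⇒≈ (fromℚ p′ - fromℚ q′) (fromℚ r) λ _ → eq)))

InUnit : ℝ → Set
InUnit x = 0ℝ ≤ x × x ≤ 1ℝ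

abs-sub-≤1 : ∀ x y → InUnit x → InUnit y → abs (x - y) ≤ 1ℝ
abs-sub-≤1 x y (0≤x , x≤1) (0≤y , y≤1) =
  abs-sub-≤ x y 1ℚ 0ℚ 1ℚ 0ℚ 1ℚ x≤1 0≤y y≤1 0≤x refl refl

abs-sub-≤½ˡ : ∀ x y → x ≈ ½ℝ → InUnit y → abs (x - y) ≤ ½ℝ
abs-sub-≤½ˡ x y x≈½ (0≤y , y≤1) =
  abs-sub-≤ x y ½ 0ℚ 1ℚ ½ ½ (≈⇒≤ x ½ℝ x≈½) 0≤y y≤1 (≈⇒≥ x ½ℝ x≈½) refl refl

abs-sub-≤½ʳ : ∀ x y → InUnit x → y ≈ ½ℝ → abs (x - y) ≤ ½ℝ
abs-sub-≤½ʳ x y (0≤x , x≤1) y≈½ =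
  abs-sub-≤ x y 1ℚ ½ ½ 0ℚ ½ x≤1 (≈⇒≥ y ½ℝ y≈½) (≈⇒≤ y ½ℝ y≈½) 0≤x refl refl

0<½ : 0ℝ < ½ℝ
0<½ = fromℚ-mono-< (ℚₚ.positive⁻¹ ½)

½<1 : ½ℝ < 1ℝ
½<1 = fromℚ-mono-< (ℚₚ.+-monoʳ-< ½ (ℚₚ.positive⁻¹ ½))

abs-sub-½-½ : ∀ x y → x ≈ ½ℝ → y ≈ ½ℝ → abs (x - y) < ½ℝ
abs-sub-½-½ x y x≈½ y≈½ = ≤-<-trans (abs (x - y)) 0ℝ ½ℝ
  (abs-sub-≤ x y ½ ½ ½ ½ 0ℚ (≈⇒≤ x ½ℝ x≈½) (≈⇒≥ y ½ℝ y≈½) (≈⇒≤ y ½ℝ y≈½) (≈⇒≥ x ½ℝ x≈½)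
    refl refl)
  0<½

abs-sub-<½-below : ∀ x y → InUnit x → InUnit y → x < ½ℝ → y < ½ℝ → abs (x - y) < ½ℝ
abs-sub-<½-below x y (0≤x , _) (0≤y , _) x<½ y<½ = abs-lub-< x y ½ℝ
  (sub-mono-<-≤ x y ½ℝ 0ℝ x<½ 0≤y) (sub-mono-<-≤ y x ½ℝ 0ℝ y<½ 0≤x)

abs-sub-<½-above : ∀ x y → InUnit x → InUnit y → ½ℝ < x → ½ℝ < y → abs (x - y) < ½ℝ
abs-sub-<½-above x y (_ , x≤1) (_ , y≤1) ½<x ½<y = abs-lub-< x y ½ℝ
  (sub-mono-≤-< x y 1ℝ ½ℝ x≤1 ½<y) (sub-mono-≤-< y x 1ℝ ½ℝ y≤1 ½<x)

Sorted : List ℝ → Set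
Sorted = AllPairs _≤_

-- The step of insertion sort. Comparisons of reals are available only under double negation, which
-- suffices because the sorted lists serve only to derive contradictions.
¬¬-insert : ∀ x {c} → Sorted c → ¬ ¬ (∃[ c′ ] (c′ ↭ x ∷ c × Sorted c′))
¬¬-insert x {[]} [] k = k (x ∷ [] , ↭-refl , [] ∷ [])
¬¬-insert x {y ∷ c} (y≤c ∷ c-sorted) k = ¬¬-excluded-middle {A = y < x} λ where
  (yes y<x) → ¬¬-insert x c-sorted λ (c′ , c′↭ , c′-sorted) →
    k (y ∷ c′ , ↭-trans (prep y c′↭) (swap y x ↭-refl)
      , All-resp-↭ (↭-sym c′↭) (<⇒≤ y x y<x ∷ y≤c) ∷ c′-sorted)
  (no x≤y) →
    k (x ∷ y ∷ c , ↭-refl , (x≤y ∷ All.map (λ {z} → ≤-trans x y z x≤y) y≤c) ∷ y≤c ∷ c-sorted)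

¬¬-sort : ∀ xs → ¬ ¬ (∃[ c ] (c ↭ xs × Sorted c))
¬¬-sort []       k = k ([] , ↭-refl , [])
¬¬-sort (x ∷ xs) k = ¬¬-sort xs λ (c , c↭xs , c-sorted) →
  ¬¬-insert x c-sorted λ (c′ , c′↭ , c′-sorted) →
  k (c′ , ↭-trans c′↭ (prep x c↭xs) , c′-sorted)

∈-map-↭ : ∀ {A B : Set} (f : A → B) {y ps} → y List.∈ map f ps →
          ∃[ p ] ∃[ qs ] (ps ↭ p ∷ qs × y ≡ f p)
∈-map-↭ f y∈ with p , p∈ps , refl ← ∈-map⁻ f y∈ with as , bs , refl ← ∈-∃++ p∈ps =
  p , as ++ bs , shift p as bs , refl

head-≤ : ∀ {x c y} → Sorted (x ∷ c) → y List.∈ x ∷ c → x ≤ y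
head-≤ {x} (x≤c ∷ _) y∈ = All.lookup (≤-refl x ∷ x≤c) y∈

-- If c₀ = d₀, re-pair c₀ with d₀ and their former partners with each other: both the pointwise
-- inequalities and a strict one survive, and the common head can be removed.
pairs⇒¬¬<ₗₑₓ : ∀ c d ps → c ↭ map proj₁ ps → d ↭ map proj₂ ps → Sorted c → Sorted d →
               All (λ (x , y) → x ≤ y) ps → Any (λ (x , y) → x < y) ps → ¬ ¬ (c <ₗₑₓ d)
pairs⇒¬¬<ₗₑₓ [] _ ps c↭ _ _ _ _ any _
  with () ← ∈-resp-↭ (↭-sym c↭) (∈-map⁺ proj₁ (proj₁ (proj₂ (List.find any))))
pairs⇒¬¬<ₗₑₓ (_ ∷ _) [] ps _ d↭ _ _ _ any _
  with () ← ∈-resp-↭ (↭-sym d↭) (∈-map⁺ proj₂ (proj₁ (proj₂ (List.find any))))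
pairs⇒¬¬<ₗₑₓ (c₀ ∷ c) (d₀ ∷ d) ps c↭ d↭ sc@(_ ∷ sc′) sd@(_ ∷ sd′) ps≤ any k =
  ¬¬-excluded-middle {A = c₀ < d₀} λ where
    (yes c₀<d₀) → k (this c₀<d₀)
    (no d₀≤c₀)  → rematch d₀≤c₀ (∈-map-↭ proj₁ (∈-resp-↭ c↭ (here refl)))
  where
  rematch : d₀ ≤ c₀ → ∃[ p ] ∃[ qs ] (ps ↭ p ∷ qs × c₀ ≡ proj₁ p) → ⊥
  rematch d₀≤c₀ ((_ , y) , qs , π , refl) =
    partner (∈-resp-↭ d↭′ (here refl)) (All-resp-↭ π ps≤) (Any-resp-↭ π any)
    where
    c↭′ : c ↭ map proj₁ qs
    c↭′ = drop-∷ (↭-trans c↭ (Perm.map⁺ proj₁ π))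
    d↭′ : d₀ ∷ d ↭ y ∷ map proj₂ qs
    d↭′ = ↭-trans d↭ (Perm.map⁺ proj₂ π)
    partner : d₀ List.∈ y ∷ map proj₂ qs → All (λ (x , y) → x ≤ y) ((c₀ , y) ∷ qs) →
              Any (λ (x , y) → x < y) ((c₀ , y) ∷ qs) → ⊥
    partner (here refl) (c₀≤y ∷ qs≤) any =
      pairs⇒¬¬<ₗₑₓ c d qs c↭′ (drop-∷ d↭′) sc′ sd′ qs≤ (strict any)
        (k ∘ next (≤-antisym c₀ d₀ c₀≤y d₀≤c₀))
      where
      strict : Any (λ (x , y) → x < y) ((c₀ , d₀) ∷ qs) → Any (λ (x , y) → x < y) qs
      strict (here c₀<d₀) = contradiction c₀<d₀ d₀≤c₀
      strict (there any)  = any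
    partner (there d₀∈) (c₀≤y ∷ qs≤) any
      with (x , _) , rs , ρ , refl ← ∈-map-↭ proj₂ d₀∈ with x≤d₀ ∷ rs≤ ← All-resp-↭ ρ qs≤ =
      pairs⇒¬¬<ₗₑₓ c d ((x , y) ∷ rs) (↭-trans c↭′ (Perm.map⁺ proj₁ ρ)) (drop-∷ d↭″) sc′ sd′
        (≤-trans x d₀ y x≤d₀ d₀≤y ∷ rs≤) (strict any)
        (k ∘ next (≤-antisym c₀ d₀ (≤-trans c₀ x d₀ c₀≤x x≤d₀) d₀≤c₀))
      where
      d↭″ : d₀ ∷ d ↭ d₀ ∷ y ∷ map proj₂ rs
      d↭″ = ↭-trans d↭′ (↭-trans (prep y (Perm.map⁺ proj₂ ρ)) (swap y d₀ ↭-refl))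
      d₀≤y : d₀ ≤ y
      d₀≤y = head-≤ sd (∈-resp-↭ (↭-sym d↭′) (here refl))
      c₀≤x : c₀ ≤ x
      c₀≤x = head-≤ sc (there (∈-resp-↭ (↭-sym (↭-trans c↭′ (Perm.map⁺ proj₁ ρ))) (here refl)))
      -- A strict pair (c₀, y) hands its strictness to the new pair, as x ≤ d₀ ≤ c₀ < y; the pair
      -- (x, d₀) cannot be strict, as d₀ ≤ c₀ ≤ x.
      strict : Any (λ (x , y) → x < y) ((c₀ , y) ∷ qs) → Any (λ (x , y) → x < y) ((x , y) ∷ rs)
      strict (here c₀<y) = here (≤-<-trans x c₀ y (≤-trans x d₀ c₀ x≤d₀ d₀≤c₀) c₀<y)
      strict (there any) with Any-resp-↭ ρ any
      ... | here x<d₀ = contradiction (≤-<-trans c₀ x d₀ c₀≤x x<d₀) d₀≤c₀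
      ... | there any = there any

-- The heads decide: c₀ ≤ x < r ≤ d₀. Membership of `y` makes `d` nonempty.
least⇒<ₗₑₓ : ∀ {c d x y} r → Sorted c → x List.∈ c → x < r → y List.∈ d → All (r ≤_) d → c <ₗₑₓ d
least⇒<ₗₑₓ {c₀ ∷ _} {d₀ ∷ _} {x} r sc x∈c x<r _ (r≤d₀ ∷ _) =
  this (<-≤-trans c₀ r d₀ (≤-<-trans c₀ x r (head-≤ sc x∈c) x<r) r≤d₀)

-- Consequences of maximality

module _ {n} {G : Graph n} {Vc : Subset n} {g : Colouring Vc} {f : Fin n → ℝ}
         (f-max : IsMaximumContrastGreyscale G Vc g f)
         {h : Fin n → ℝ} (h-compatible : IsCompatibleGreyscale Vc g h) where

  private
    es = Graph.edges G

    -- Maximality speaks only of contrast vectors that are given; sorting supplies them under double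
    -- negation.
    ¬¬-contrastVectors : ¬ ¬ (∃[ c ] ∃[ d ]
      (c ↭ map (contrast f) es × Sorted c × d ↭ map (contrast h) es × Sorted d × ¬ (c <ₗₑₓ d)))
    ¬¬-contrastVectors k = ¬¬-sort (map (contrast f) es) λ (c , c↭ , sc) →
      ¬¬-sort (map (contrast h) es) λ (d , d↭ , sd) → k (c , d , c↭ , sc , d↭ , sd ,
        IsMaximumContrastGreyscale.maximum f-max h h-compatible c d
          (c↭ , AllPairs⇒Linked sc) (d↭ , AllPairs⇒Linked sd))

  -- An edge of `f` with contrast below `r` would put the least entry for `f` strictly below the
  -- least entry for `h`.
  contrast-lowerBound : ∀ r → (∀ {e} → e List.∈ es → r ≤ contrast h e) →
                        ∀ {e} → e List.∈ es → r ≤ contrast f e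
  contrast-lowerBound r r≤h {e} e∈ fe<r =
    ¬¬-contrastVectors λ (c , d , c↭ , sc , d↭ , sd , c≮d) → c≮d
      (least⇒<ₗₑₓ r sc (∈-resp-↭ (↭-sym c↭) (∈-map⁺ (contrast f) e∈)) fe<r
        (∈-resp-↭ (↭-sym d↭) (∈-map⁺ (contrast h) e∈))
        (All-resp-↭ (↭-sym d↭) (Allₚ.map⁺ (All.tabulate r≤h))))

  -- Pairing the two contrasts of each edge turns one strict edge into a lexicographic gain of `h`
  -- over `f`.
  contrast-notDominated : (∀ {e} → e List.∈ es → contrast f e ≤ contrast h e) →
                          ∀ {e} → e List.∈ es → contrast h e ≤ contrast f e
  contrast-notDominated f≤h {e} e∈ fe<he =
    ¬¬-contrastVectors λ (c , d , c↭ , sc , d↭ , sd , c≮d) →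
      pairs⇒¬¬<ₗₑₓ c d (map (λ e → contrast f e , contrast h e) es)
        (subst (c ↭_) (map-∘ es) c↭) (subst (d ↭_) (map-∘ es) d↭) sc sd
        (Allₚ.map⁺ (All.tabulate f≤h)) (Anyₚ.map⁺ (List.lose e∈ fe<he)) c≮d

-- Adjacency and the edge list

module _ {n} (G : Graph n) where

  private
    edge? : ∀ ((u , v) : Fin n × Fin n) → Dec (u Fin.< v × Adj G u v)
    edge? (u , v) = (u Finₚ.<? v) ×-dec Graph.adj? G u v

  ∈-edges⇒Adj : ∀ {u v} → (u , v) List.∈ Graph.edges G → Adj G u v
  ∈-edges⇒Adj e∈ = proj₂ (proj₂
    (∈-filter⁻ edge? {xs = cartesianProduct (allFin n) (allFin n)} e∈))

  Adj⇒∈-edges : ∀ {u v} → Adj G u v → (u , v) List.∈ Graph.edges G ⊎ (v , u) List.∈ Graph.edges G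
  Adj⇒∈-edges {u} {v} u~v with Finₚ.<-cmp u v
  ... | tri< u<v _ _ = inj₁ (∈-filter⁺ edge? (∈-cartesianProduct⁺ (∈-allFin u) (∈-allFin v))
                              (u<v , u~v))
  ... | tri≈ _ refl _ = contradiction u~v (Graph.irrefl G)
  ... | tri> _ _ v<u = inj₂ (∈-filter⁺ edge? (∈-cartesianProduct⁺ (∈-allFin v) (∈-allFin u))
                              (v<u , Graph.adj-sym G u~v))

-- Rooted trees

module _ {n} (G : Graph n) where

  -- Indexed by length and extended at the far end: this makes it decidable, so that a shortest walk
  -- can be searched for, and the last step of that walk exhibits a parent.
  Walk : ℕ → Fin n → Fin n → Set
  Walk zero    u v = u ≡ v
  Walk (suc k) u v = ∃[ w ] (Walk k u w × Adj G w v)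

  walk? : ∀ k u v → Dec (Walk k u v)
  walk? zero    u v = u Finₚ.≟ v
  walk? (suc k) u v = Finₚ.any? λ w → walk? k u w ×-dec Graph.adj? G w v

  star⇒walk : ∀ {k u v w} → Walk k u v → Star (Adj G) v w → ∃[ l ] Walk l u w
  star⇒walk {k} p Star.ε      = k , p
  star⇒walk p (v~w ◅ w⇝x) = star⇒walk (_ , p , v~w) w⇝x

least : ∀ {P : ℕ → Set} → (∀ k → Dec (P k)) → ∀ k → P k → ∃[ m ] (P m × ∀ j → P j → m ℕ.≤ j)
least P? zero p = zero , p , λ _ _ → ℕ.z≤n
least P? (suc k) p with P? zero
... | yes p₀ = zero , p₀ , λ _ _ → ℕ.z≤n
... | no ¬p₀ with least (P? ∘ suc) k p
...   | m , pm , m-min = suc m , pm , λ where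
  zero    p₀ → contradiction p₀ ¬p₀
  (suc j) pj → ℕ.s≤s (m-min j pj)

-- Connectedness and acyclicity enter the colouring argument only through this record.
record Rooting {n} (G : Graph n) (root : Fin n) : Set where
  field
    depth       : Fin n → ℕ
    depth-root  : depth root ≡ 0
    depth≡0     : ∀ {v} → depth v ≡ 0 → v ≡ root

  IsParent : Fin n → Fin n → Set
  IsParent v u = Adj G u v × suc (depth u) ≡ depth v

  field
    parent        : ∀ {k} v → depth v ≡ suc k → ∃[ u ] IsParent v u
    parent-unique : ∀ {v u w} → IsParent v u → IsParent v w → u ≡ w
    adj⇒parent    : ∀ {u v} → Adj G u v → IsParent v u ⊎ IsParent u v

Linked-∷ʳ : ∀ {A : Set} {R : A → A → Set} xs {y z} →
            Linked R (xs ++ y ∷ []) → R y z → Linked R ((xs ++ y ∷ []) ++ z ∷ [])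
Linked-∷ʳ []            [-]         y~z = y~z ∷ [-]
Linked-∷ʳ (x ∷ [])      (x~y ∷ [-]) y~z = x~y ∷ y~z ∷ [-]
Linked-∷ʳ (x ∷ x′ ∷ xs) (x~x′ ∷ l)  y~z = x~x′ ∷ Linked-∷ʳ (x′ ∷ xs) l y~z

module _ {n} (T : Graph n) (T-tree : IsTree T) (root : Fin n) where

  private
    distance : ∀ v → ∃[ m ] (Walk T m root v × ∀ j → Walk T j root v → m ℕ.≤ j)
    distance v with l , p ← star⇒walk T {0} refl (proj₁ T-tree root v) =
      least (λ k → walk? T k root v) l p

    depth : Fin n → ℕ
    depth v = proj₁ (distance v)

    walk : ∀ v → Walk T (depth v) root v
    walk v = proj₁ (proj₂ (distance v))

    depth-min : ∀ {v j} → Walk T j root v → depth v ℕ.≤ j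
    depth-min {v} = proj₂ (proj₂ (distance v)) _

    depth-adj : ∀ {u v} → Adj T u v → depth v ℕ.≤ suc (depth u)
    depth-adj {u} u~v = depth-min (u , walk u , u~v)

    depth≡0 : ∀ {v} → depth v ≡ 0 → v ≡ root
    depth≡0 {v} eq = sym (subst (λ k → Walk T k root v) eq (walk v))

    parent : ∀ {k} v → depth v ≡ suc k → ∃[ u ] (Adj T u v × suc (depth u) ≡ depth v)
    parent {k} v eq with u , p , u~v ← subst (λ k → Walk T k root v) eq (walk v) =
      u , u~v ,
      ℕₚ.≤-antisym (subst (suc (depth u) ℕ.≤_) (sym eq) (ℕ.s≤s (depth-min p))) (depth-adj u~v)

    -- The interior of a path joining two vertices of depth `k` through strictly smaller depths; it
    -- is what closes up to a forbidden cycle.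
    Detour : ℕ → Fin n → Fin n → List (Fin n) → Set
    Detour k u v ws = 1 ℕ.≤ length ws × All (λ w → depth w ℕ.< k) ws × Unique ws ×
                      Linked (Adj T) (u ∷ ws ++ v ∷ [])

    detour-unique : ∀ {k u v ws} → u ≢ v → depth u ≡ k → depth v ≡ k → Detour k u v ws →
                    Unique (u ∷ ws ++ v ∷ [])
    detour-unique u≢v du dv (_ , ws< , ws! , _) =
      Allₚ.++⁺ (All.map (λ {w} w<k u≡w → ℕₚ.<-irrefl (trans (sym (cong depth u≡w)) du) w<k) ws<)
               (u≢v ∷ [])
      ∷ AllPairsₚ.++⁺ ws! ([] ∷ [])
          (All.map (λ {w} w<k → (λ w≡v → ℕₚ.<-irrefl (trans (cong depth w≡v) dv) w<k) ∷ []) ws<)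

    -- Ascend from u and v through parents until the two branches meet.
    detour : ∀ k {u v} → u ≢ v → depth u ≡ k → depth v ≡ k → ∃[ ws ] Detour k u v ws
    detour zero u≢v du dv = contradiction (trans (depth≡0 du) (sym (depth≡0 dv))) u≢v
    detour (suc k) {u} {v} u≢v du dv with parent u du | parent v dv
    ... | x , x~u , dx | y , y~v , dy with x Finₚ.≟ y
    ...   | yes refl = x ∷ [] , ℕ.s≤s ℕ.z≤n , ℕₚ.≤-reflexive (trans dx du) ∷ [] , [] ∷ [] ,
                       Graph.adj-sym T x~u ∷ y~v ∷ [-]
    ...   | no x≢y with dx≡k ← ℕₚ.suc-injective (trans dx du)
                   with dy≡k ← ℕₚ.suc-injective (trans dy dv)
                   with ws , D@(_ , ws< , _ , linked) ← detour k x≢y dx≡k dy≡k =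
      x ∷ ws ++ y ∷ [] , ℕ.s≤s ℕ.z≤n
      , ℕₚ.≤-reflexive (cong suc dx≡k) ∷
        Allₚ.++⁺ (All.map ℕₚ.m<n⇒m<1+n ws<) (ℕₚ.≤-reflexive (cong suc dy≡k) ∷ [])
      , detour-unique x≢y dx≡k dy≡k D
      , Graph.adj-sym T x~u ∷ Linked-∷ʳ (x ∷ ws) linked y~v

    length-∷ʳ : ∀ (ws : List (Fin n)) {v} → 1 ℕ.≤ length ws → 2 ℕ.≤ length (ws ++ v ∷ [])
    length-∷ʳ (_ ∷ [])    _ = ℕ.s≤s (ℕ.s≤s ℕ.z≤n)
    length-∷ʳ (_ ∷ _ ∷ _) _ = ℕ.s≤s (ℕ.s≤s ℕ.z≤n)

    adj⇒≢ : ∀ {u v} → Adj T u v → u ≢ v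
    adj⇒≢ u~v refl = Graph.irrefl T u~v

    -- An edge within one level, together with a detour between its ends, would form a cycle.
    adj⇒depth≢ : ∀ {u v} → Adj T u v → depth u ≢ depth v
    adj⇒depth≢ {u} {v} u~v eq
      with ws , D@(1≤ , _ , _ , linked) ← detour (depth v) (adj⇒≢ u~v) eq refl =
      proj₂ T-tree u (ws ++ v ∷ [])
        ( length-∷ʳ ws 1≤
        , detour-unique (adj⇒≢ u~v) eq refl D
        , Linked-∷ʳ (u ∷ ws) linked (Graph.adj-sym T u~v))

    -- Two distinct parents lie on one level; a detour between them and the two edges to `v` would
    -- form a cycle.
    parent-unique : ∀ {v u w} → Adj T u v × suc (depth u) ≡ depth v →
                    Adj T w v × suc (depth w) ≡ depth v → u ≡ w
    parent-unique {v} {u} {w} (u~v , du) (w~v , dw) with u Finₚ.≟ w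
    ... | yes u≡w = u≡w
    ... | no u≢w with du≡dw ← ℕₚ.suc-injective (trans du (sym dw))
                 with ws , D@(1≤ , ws< , ws! , linked) ← detour (depth w) u≢w du≡dw refl =
      contradiction
        ( ℕₚ.m≤n⇒m≤1+n (length-∷ʳ ws 1≤)
        , (v≢ du ∷ Allₚ.++⁺ (All.map (λ {x} x<w v≡x →
              ℕₚ.<-irrefl (cong depth (sym v≡x)) (ℕₚ.<-trans x<w (ℕₚ.≤-reflexive dw))) ws<)
              (v≢ dw ∷ []))
          ∷ detour-unique u≢w du≡dw refl D
        , Graph.adj-sym T u~v ∷ Linked-∷ʳ (u ∷ ws) linked w~v)
        (proj₂ T-tree v (u ∷ ws ++ w ∷ []))
      where
      v≢ : ∀ {x} → suc (depth x) ≡ depth v → v ≢ x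
      v≢ eq refl = ℕₚ.1+n≢n eq

    adj⇒parent : ∀ {u v} → Adj T u v →
                 (Adj T u v × suc (depth u) ≡ depth v) ⊎ (Adj T v u × suc (depth v) ≡ depth u)
    adj⇒parent {u} {v} u~v with ℕₚ.<-cmp (depth u) (depth v)
    ... | tri< u<v _ _ = inj₁ (u~v , ℕₚ.≤-antisym u<v (depth-adj u~v))
    ... | tri≈ _ eq _  = contradiction eq (adj⇒depth≢ u~v)
    ... | tri> _ _ v<u = inj₂ (v~u , ℕₚ.≤-antisym v<u (depth-adj v~u))
      where v~u = Graph.adj-sym T u~v

  rooting : Rooting T root
  rooting = record
    { depth         = depth
    ; depth-root    = ℕₚ.n≤0⇒n≡0 (depth-min {root} {0} refl)
    ; depth≡0       = depth≡0
    ; parent        = parent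
    ; parent-unique = parent-unique
    ; adj⇒parent    = adj⇒parent
    }

-- Greyscales with values 0, ½ and 1

bool : Bool → ℝ
bool false = 0ℝ
bool true  = 1ℝ

toBool : Fin 2 → Bool
toBool Fin.zero           = false
toBool (Fin.suc Fin.zero) = true

colour≡bool : ∀ i → colour i ≡ bool (toBool i)
colour≡bool Fin.zero           = refl
colour≡bool (Fin.suc Fin.zero) = refl

toBool-injective : ∀ i j → toBool i ≡ toBool j → i ≡ j
toBool-injective Fin.zero           Fin.zero           _ = refl
toBool-injective Fin.zero           (Fin.suc Fin.zero) ()
toBool-injective (Fin.suc Fin.zero) Fin.zero           ()
toBool-injective (Fin.suc Fin.zero) (Fin.suc Fin.zero) _ = refl

-- Rounding of a value other than ½ to 0 or 1, as a relation because the order cannot be decided.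
Side : Bool → ℝ → Set
Side false x = x < ½ℝ
Side true  x = ½ℝ < x

≈bool⇒Side : ∀ β x → x ≈ bool β → Side β x
≈bool⇒Side false x x≈0 = ≤-<-trans x 0ℝ ½ℝ (≈⇒≤ x 0ℝ x≈0) 0<½
≈bool⇒Side true  x x≈1 = <-≤-trans ½ℝ 1ℝ x ½<1 (≈⇒≥ x 1ℝ x≈1)

¬Side-½ : ∀ β x → Side β x → ¬ x ≈ ½ℝ
¬Side-½ false x x<½ x≈½ = ≈⇒≥ x ½ℝ x≈½ x<½
¬Side-½ true  x ½<x x≈½ = ≈⇒≤ x ½ℝ x≈½ ½<x

Side-unique : ∀ β γ x → Side β x → Side γ x → β ≡ γ
Side-unique false false x _ _     = refl
Side-unique false true  x x<½ ½<x = contradiction ½<x (<⇒≤ x ½ℝ x<½)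
Side-unique true  false x ½<x x<½ = contradiction ½<x (<⇒≤ x ½ℝ x<½)
Side-unique true  true  x _ _     = refl

abs-sub-<½ : ∀ β x y → InUnit x → InUnit y → Side β x → Side β y → abs (x - y) < ½ℝ
abs-sub-<½ false = abs-sub-<½-below
abs-sub-<½ true  = abs-sub-<½-above

¬¬-side : ∀ x → ¬ ¬ (x ≈ ½ℝ ⊎ ∃[ β ] Side β x)
¬¬-side x k = ¬¬-excluded-middle {A = x < ½ℝ} λ where
  (yes x<½) → k (inj₂ (false , x<½))
  (no  ½≤x) → ¬¬-excluded-middle {A = ½ℝ < x} λ where
    (yes ½<x) → k (inj₂ (true , ½<x))
    (no  x≤½) → k (inj₁ (≤-antisym x ½ℝ x≤½ ½≤x))

-- Holds because the range of the quantifier is finite; it makes undecidable facts available at all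
-- vertices at once.
¬¬-∀ : ∀ {n} {P : Fin n → Set} → (∀ i → ¬ ¬ P i) → ¬ ¬ (∀ i → P i)
¬¬-∀ = Finₚ.sequence (RawMonad.rawApplicative ¬¬-Monad)

module _ {n} {H : Fin n → Set} (H? : ∀ v → Dec (H v)) (χ : Fin n → Bool) where

  -- Every greyscale that is compared with `f` has this form.
  shade : Fin n → ℝ
  shade v = if does (H? v) then ½ℝ else bool (χ v)

  private
    bool-InUnit : ∀ β → InUnit (bool β)
    bool-InUnit false = ≤-refl 0ℝ , <⇒≤ 0ℝ 1ℝ (fromℚ-mono-< (ℚₚ.positive⁻¹ 1ℚ))
    bool-InUnit true  = <⇒≤ 0ℝ 1ℝ (fromℚ-mono-< (ℚₚ.positive⁻¹ 1ℚ)) , ≤-refl 1ℝ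

    shade-InUnit : ∀ v → InUnit (shade v)
    shade-InUnit v with H? v
    ... | yes _ = <⇒≤ 0ℝ ½ℝ 0<½ , <⇒≤ ½ℝ 1ℝ ½<1
    ... | no  _ = bool-InUnit (χ v)

    ≡⇒≈bool : ∀ {x} β → x ≡ bool β → x ≈ bool β
    ≡⇒≈bool β refl = ≡⇒≈ (bool β) (bool β) λ _ → refl

    shade-∉H : ∀ {v} → ¬ H v → shade v ≡ bool (χ v)
    shade-∉H {v} v∉H with H? v
    ... | yes v∈H = contradiction v∈H v∉H
    ... | no  _   = refl

    -- A greyscale must attain both 0 and 1; two unshaded vertices of opposite colours witness this.
    hits : ∀ {u v} → ¬ H u → ¬ H v → χ u ≡ not (χ v) → ∀ β → ∃[ w ] shade w ≈ bool β
    hits {u} {v} u∉H v∉H χu≡ β with χ v in χv≡ | β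
    ... | false | false = v , ≡⇒≈bool false (trans (shade-∉H v∉H) (cong bool χv≡))
    ... | false | true  = u , ≡⇒≈bool true  (trans (shade-∉H u∉H) (cong bool χu≡))
    ... | true  | false = u , ≡⇒≈bool false (trans (shade-∉H u∉H) (cong bool χu≡))
    ... | true  | true  = v , ≡⇒≈bool true  (trans (shade-∉H v∉H) (cong bool χv≡))

  shade-compatible : ∀ {Vc : Subset n} {g : Colouring Vc} →
    (∀ v (v∈Vc : v ∈ Vc) → ¬ H v × χ v ≡ toBool (g v v∈Vc)) →
    ∀ {u v} → ¬ H u → ¬ H v → χ u ≡ not (χ v) → IsCompatibleGreyscale Vc g shade
  shade-compatible {g = g} χ-Vc u∉H v∉H χu≡ = record
    { greyscale  = record
      { lower = λ v → proj₁ (shade-InUnit v)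
      ; upper = λ v → proj₂ (shade-InUnit v)
      ; hits0 = hits u∉H v∉H χu≡ false
      ; hits1 = hits u∉H v∉H χu≡ true
      }
    ; compatible = λ v v∈Vc → let (v∉H , χv≡) = χ-Vc v v∈Vc in
        subst (shade v ≈_) (sym (colour≡bool (g v v∈Vc)))
          (≡⇒≈bool (toBool (g v v∈Vc)) (trans (shade-∉H v∉H) (cong bool χv≡)))
    }

  1≤contrast-shade : ∀ {u v} → ¬ H u → ¬ H v → χ u ≡ not (χ v) → 1ℝ ≤ contrast shade (u , v)
  1≤contrast-shade {u} {v} u∉H v∉H χu≡ rewrite shade-∉H u∉H | shade-∉H v∉H | χu≡ with χ v
  ... | false = ≈⇒≤ 1ℝ (abs (1ℝ - 0ℝ)) (≡⇒≈ 1ℝ (abs (1ℝ - 0ℝ)) λ _ → refl)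
  ... | true  = ≈⇒≤ 1ℝ (abs (0ℝ - 1ℝ)) (≡⇒≈ 1ℝ (abs (0ℝ - 1ℝ)) λ _ → refl)

  ½≤contrast-shade : ∀ {u v} → (H u → ¬ H v) → (¬ H u → ¬ H v → χ u ≡ not (χ v)) →
                     ½ℝ ≤ contrast shade (u , v)
  ½≤contrast-shade {u} {v} independent proper = cases (H? u) (H? v)
    where
    shade-∈H : ∀ {v} → H v → shade v ≡ ½ℝ
    shade-∈H {v} v∈H with H? v
    ... | yes _   = refl
    ... | no  v∉H = contradiction v∈H v∉H
    cases : Dec (H u) → Dec (H v) → ½ℝ ≤ contrast shade (u , v)
    cases (yes u∈H) (yes v∈H) = contradiction v∈H (independent u∈H)
    cases (no  u∉H) (no  v∉H) = ≤-trans ½ℝ 1ℝ (contrast shade (u , v)) (<⇒≤ ½ℝ 1ℝ ½<1)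
      (1≤contrast-shade u∉H v∉H (proper u∉H v∉H))
    cases (yes u∈H) (no  v∉H) rewrite shade-∈H u∈H | shade-∉H v∉H with χ v
    ... | false = ≈⇒≤ ½ℝ (abs (½ℝ - 0ℝ)) (≡⇒≈ ½ℝ (abs (½ℝ - 0ℝ)) λ _ → refl)
    ... | true  = ≈⇒≤ ½ℝ (abs (½ℝ - 1ℝ)) (≡⇒≈ ½ℝ (abs (½ℝ - 1ℝ)) λ _ → refl)
    cases (no  u∉H) (yes v∈H) rewrite shade-∉H u∉H | shade-∈H v∈H with χ u
    ... | false = ≈⇒≤ ½ℝ (abs (0ℝ - ½ℝ)) (≡⇒≈ ½ℝ (abs (0ℝ - ½ℝ)) λ _ → refl)
    ... | true  = ≈⇒≤ ½ℝ (abs (1ℝ - ½ℝ)) (≡⇒≈ ½ℝ (abs (1ℝ - ½ℝ)) λ _ → refl)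

-- The ½-vertices of a maximum contrast greyscale

parity : ℕ → Bool
parity zero    = false
parity (suc k) = not (parity k)

ProperColouring : ∀ {n} → Graph n → (Fin n → Bool) → Set
ProperColouring G p = ∀ {u v} → Adj G u v → p u ≡ not (p v)

parity-proper : ∀ {n} {G : Graph n} {root} (R : Rooting G root) →
                ProperColouring G (parity ∘ Rooting.depth R)
parity-proper R u~v with Rooting.adj⇒parent R u~v
... | inj₁ (_ , eq) = trans (sym (not-involutive _)) (cong (not ∘ parity) eq)
... | inj₂ (_ , eq) = cong parity (sym eq)

xor-cancelˡ : ∀ x y → x xor (x xor y) ≡ y
xor-cancelˡ x y = trans (sym (xor-assoc x x y)) (cong (_xor y) (xor-same x))

-- Counting in finite subsets

∣p∪q∣≤∣p∣+∣q∣ : ∀ {n} (p q : Subset n) → ∣ p ∪ q ∣ ℕ.≤ ∣ p ∣ ℕ.+ ∣ q ∣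
∣p∪q∣≤∣p∣+∣q∣ []          []          = ℕ.z≤n
∣p∪q∣≤∣p∣+∣q∣ (false ∷ p) (false ∷ q) = ∣p∪q∣≤∣p∣+∣q∣ p q
∣p∪q∣≤∣p∣+∣q∣ (true  ∷ p) (false ∷ q) = ℕ.s≤s (∣p∪q∣≤∣p∣+∣q∣ p q)
∣p∪q∣≤∣p∣+∣q∣ (false ∷ p) (true  ∷ q) =
  subst (suc ∣ p ∪ q ∣ ℕ.≤_) (sym (ℕₚ.+-suc ∣ p ∣ ∣ q ∣)) (ℕ.s≤s (∣p∪q∣≤∣p∣+∣q∣ p q))
∣p∪q∣≤∣p∣+∣q∣ (true  ∷ p) (true  ∷ q) = ℕ.s≤s
  (ℕₚ.≤-trans (∣p∪q∣≤∣p∣+∣q∣ p q) (ℕₚ.+-monoʳ-≤ ∣ p ∣ (ℕₚ.n≤1+n ∣ q ∣)))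

covered⇒∣S∣≤2 : ∀ {n} {S : Subset n} x y → (∀ v → v ∈ S → v ≡ x ⊎ v ≡ y) → ∣ S ∣ ℕ.≤ 2
covered⇒∣S∣≤2 {S = S} x y covered = begin
  ∣ S ∣                     ≤⟨ p⊆q⇒∣p∣≤∣q∣ S⊆ ⟩
  ∣ ⁅ x ⁆ ∪ ⁅ y ⁆ ∣         ≤⟨ ∣p∪q∣≤∣p∣+∣q∣ ⁅ x ⁆ ⁅ y ⁆ ⟩
  ∣ ⁅ x ⁆ ∣ ℕ.+ ∣ ⁅ y ⁆ ∣   ≡⟨ cong₂ ℕ._+_ (∣⁅x⁆∣≡1 x) (∣⁅x⁆∣≡1 y) ⟩
  2                         ∎
  where
  open ℕₚ.≤-Reasoning
  S⊆ : S ⊆ ⁅ x ⁆ ∪ ⁅ y ⁆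
  S⊆ {v} v∈S with covered v v∈S
  ... | inj₁ refl = x∈p∪q⁺ (inj₁ (x∈⁅x⁆ x))
  ... | inj₂ refl = x∈p∪q⁺ (inj₂ (x∈⁅x⁆ y))

elements : ∀ {n} → Subset n → List (Fin n)
elements []          = []
elements (true  ∷ p) = Fin.zero ∷ map Fin.suc (elements p)
elements (false ∷ p) = map Fin.suc (elements p)

length-elements : ∀ {n} (p : Subset n) → length (elements p) ≡ ∣ p ∣
length-elements []          = refl
length-elements (true  ∷ p) = cong suc (trans (length-map Fin.suc (elements p)) (length-elements p))
length-elements (false ∷ p) = trans (length-map Fin.suc (elements p)) (length-elements p)

∈-elements⁺ : ∀ {n} {p : Subset n} {v} → v ∈ p → v List.∈ elements p
∈-elements⁺ {p = true  ∷ p} Vec.here        = here refl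
∈-elements⁺ {p = true  ∷ p} (Vec.there v∈p) = there (∈-map⁺ Fin.suc (∈-elements⁺ v∈p))
∈-elements⁺ {p = false ∷ p} (Vec.there v∈p) = ∈-map⁺ Fin.suc (∈-elements⁺ v∈p)

∈-elements⁻ : ∀ {n} {p : Subset n} {v} → v List.∈ elements p → v ∈ p
∈-elements⁻ {p = true  ∷ p} (here refl) = Vec.here
∈-elements⁻ {p = true  ∷ p} (there v∈) with _ , w∈ , refl ← ∈-map⁻ Fin.suc v∈ =
  Vec.there (∈-elements⁻ w∈)
∈-elements⁻ {p = false ∷ p} v∈ with _ , w∈ , refl ← ∈-map⁻ Fin.suc v∈ =
  Vec.there (∈-elements⁻ w∈)

∣p∣≡3⇒elements : ∀ {n} (p : Subset n) → ∣ p ∣ ≡ 3 →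
  ∃[ x ] ∃[ y ] ∃[ z ] (x ∈ p × y ∈ p × z ∈ p × ∀ v → v ∈ p → v ≡ x ⊎ v ≡ y ⊎ v ≡ z)
∣p∣≡3⇒elements p ∣p∣≡3
  with elements p | ∈-elements⁺ {p = p} | ∈-elements⁻ {p = p} | trans (length-elements p) ∣p∣≡3
... | x ∷ y ∷ z ∷ [] | ∈⁺ | ∈⁻ | _ =
  x , y , z , ∈⁻ (here refl) , ∈⁻ (there (here refl)) , ∈⁻ (there (there (here refl))) ,
  λ v v∈p → cases (∈⁺ v∈p)
  where
  cases : ∀ {v} → v List.∈ x ∷ y ∷ z ∷ [] → v ≡ x ⊎ v ≡ y ⊎ v ≡ z
  cases (here v≡x)                 = inj₁ v≡x
  cases (there (here v≡y))         = inj₂ (inj₁ v≡y)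
  cases (there (there (here v≡z))) = inj₂ (inj₂ v≡z)

-- Phases of the precoloured vertices

module _ {n} {T : Graph n} (T-tree : IsTree T) {Vc : Subset n} {g : Colouring Vc}
         (g-proper : ∀ u v (u∈Vc : u ∈ Vc) (v∈Vc : v ∈ Vc) → Adj T u v → g u u∈Vc ≢ g v v∈Vc)
         {f : Fin n → ℝ} (f-max : IsMaximumContrastGreyscale T Vc g f)
         {p : Fin n → Bool} (p-proper : ProperColouring T p) where

  private
    open IsMaximumContrastGreyscale f-max using (isCompatibleGreyscale)
    open IsCompatibleGreyscale isCompatibleGreyscale
    open IsGreyscale greyscale

    es = Graph.edges T

    f-InUnit : ∀ v → InUnit (f v)
    f-InUnit v = lower v , upper v

    f≈g : ∀ v (v∈Vc : v ∈ Vc) → f v ≈ bool (toBool (g v v∈Vc))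
    f≈g v v∈Vc = subst (f v ≈_) (colour≡bool (g v v∈Vc)) (compatible v v∈Vc)

    f-½⇒∉Vc : ∀ {v} → f v ≈ ½ℝ → ¬ v ∈ Vc
    f-½⇒∉Vc {v} fv≈½ v∈Vc = ¬Side-½ β (f v) (≈bool⇒Side β (f v) (f≈g v v∈Vc)) fv≈½
      where β = toBool (g v v∈Vc)

    contrast-½ : ∀ {u v} → f u ≈ ½ℝ ⊎ f v ≈ ½ℝ → contrast f (u , v) ≤ ½ℝ
    contrast-½ {u} {v} (inj₁ fu≈½) = abs-sub-≤½ˡ (f u) (f v) fu≈½ (f-InUnit v)
    contrast-½ {u} {v} (inj₂ fv≈½) = abs-sub-≤½ʳ (f u) (f v) (f-InUnit u) fv≈½

    -- Tells with which of the two proper colourings of T, p and its complement, g agrees at v.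
    phase : ∀ {v} → v ∈ Vc → Bool
    phase {v} v∈Vc = p v xor toBool (g v v∈Vc)

    p-xor-phase : ∀ {v} (v∈Vc : v ∈ Vc) → p v xor phase v∈Vc ≡ toBool (g v v∈Vc)
    p-xor-phase {v} v∈Vc = xor-cancelˡ (p v) (toBool (g v v∈Vc))

    -- `g` takes a membership proof as an argument, so this rests on uniqueness of such proofs.
    phase-irrelevant : ∀ {u v} → u ≡ v → (u∈Vc : u ∈ Vc) (v∈Vc : v ∈ Vc) → phase u∈Vc ≡ phase v∈Vc
    phase-irrelevant refl u∈Vc v∈Vc = cong phase ([]=-irrelevant u∈Vc v∈Vc)

    not-xor : ∀ {x y} → x ≡ not y → ∀ t → x xor t ≡ not (y xor t)
    not-xor {y = y} refl t = sym (not-distribˡ-xor y t)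

    xor-proper : ∀ {s : Fin n → Bool} {u v} → Adj T u v → s u ≡ s v →
                 p u xor s u ≡ not (p v xor s v)
    xor-proper {s} {u} {v} u~v su≡sv =
      trans (cong (p u xor_) su≡sv) (not-xor (p-proper u~v) (s v))

    -- Along such an edge both `p` and `g` flip, so their xor does not change.
    adj⇒phase≡ : ∀ {u v} (u∈Vc : u ∈ Vc) (v∈Vc : v ∈ Vc) → Adj T u v → phase u∈Vc ≡ phase v∈Vc
    adj⇒phase≡ {u} {v} u∈Vc v∈Vc u~v =
      trans (cong (_xor γ) (p-proper u~v))
        (trans (sym (not-distribˡ-xor (p v) γ))
          (trans (not-distribʳ-xor (p v) γ) (cong (p v xor_) (sym δ≡))))
      where
      γ = toBool (g u u∈Vc)
      δ≡ : toBool (g v v∈Vc) ≡ not γ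
      δ≡ = ¬-not λ eq → g-proper u v u∈Vc v∈Vc u~v (toBool-injective _ _ (sym eq))

    -- The edge list holds each edge in one orientation, so a bound valid on the list is obtained
    -- for one unspecified order of the ends.
    edge-with : ∀ {u v} → Adj T u v → (P : Fin n × Fin n → Set) →
                (∀ {e} → e List.∈ es → P e) → P (u , v) ⊎ P (v , u)
    edge-with u~v P P-edges = [ inj₁ ∘ P-edges , inj₂ ∘ P-edges ]′ (Adj⇒∈-edges T u~v)

  -- There is no ½-vertex at all: an edge at one would have contrast at most ½, while maximality
  -- forces contrast 1. The covering by `a` alone is therefore vacuous.
  consistent⇒∣½∣≤2 : ∀ {a} (a∈Vc : a ∈ Vc) → (∀ {v} (v∈Vc : v ∈ Vc) → phase v∈Vc ≡ phase a∈Vc) →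
                     CardAtMost 2 (λ v → f v ≈ ½ℝ)
  consistent⇒∣½∣≤2 {a} a∈Vc consistent S S-½ = covered⇒∣S∣≤2 a a λ w w∈S →
    contradiction (S-½ w w∈S) (f≉½ w)
    where
    open Rooting (rooting T T-tree a)
    χ : Fin n → Bool
    χ v = p v xor phase a∈Vc
    h = shade {H = λ _ → ⊥} (λ _ → no id) χ
    f≉½ : ∀ w → ¬ f w ≈ ½ℝ
    f≉½ w fw≈½ with depth w in dw
    ... | zero  = f-½⇒∉Vc fw≈½ (subst (_∈ Vc) (sym (depth≡0 dw)) a∈Vc)
    ... | suc _ with u , u~w , _ ← parent w dw =
      [ (λ 1≤ → 1≤ (≤-<-trans (contrast f (u , w)) ½ℝ 1ℝ (contrast-½ (inj₂ fw≈½)) ½<1))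
      , (λ 1≤ → 1≤ (≤-<-trans (contrast f (w , u)) ½ℝ 1ℝ (contrast-½ (inj₁ fw≈½)) ½<1)) ]′
      (edge-with u~w (λ e → 1ℝ ≤ contrast f e) (contrast-lowerBound f-max h-compatible 1ℝ 1≤h))
      where
      h-compatible : IsCompatibleGreyscale Vc g h
      h-compatible = shade-compatible (λ _ → no id) χ
        (λ v v∈Vc → id , trans (cong (p v xor_) (sym (consistent v∈Vc))) (p-xor-phase v∈Vc))
        -- The edge from `w` to its parent supplies vertices of both colours.
        {u} {w} id id (not-xor (p-proper u~w) (phase a∈Vc))
      1≤h : ∀ {e} → e List.∈ es → 1ℝ ≤ contrast h e
      1≤h e∈ = 1≤contrast-shade (λ _ → no id) χ id id
        (not-xor (p-proper (∈-edges⇒Adj T e∈)) (phase a∈Vc))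

  -- One precoloured vertex out of phase

  module _ {a b c} (a∈Vc : a ∈ Vc) (b∈Vc : b ∈ Vc) (c∈Vc : c ∈ Vc)
           (Vc⊆abc : ∀ v → v ∈ Vc → v ≡ a ⊎ v ≡ b ⊎ v ≡ c)
           (phase-b : phase b∈Vc ≡ not (phase a∈Vc)) (phase-c : phase c∈Vc ≡ not (phase a∈Vc)) where

    private
      -- With the root at `a`, the path from `a` to a vertex is its chain of ancestors.
      open Rooting (rooting T T-tree a)

      α = phase a∈Vc

      phases : ∀ {P : Fin n → Set} → (∀ v → Dec (P v)) → Fin n → Bool
      phases P? v = if does (P? v) then not α else α

      phases-yes : ∀ {P : Fin n → Set} (P? : ∀ v → Dec (P v)) {v} → P v → phases P? v ≡ not α
      phases-yes P? {v} Pv with P? v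
      ... | yes _  = refl
      ... | no ¬Pv = contradiction Pv ¬Pv

      phases-no : ∀ {P : Fin n → Set} (P? : ∀ v → Dec (P v)) {v} → ¬ P v → phases P? v ≡ α
      phases-no P? {v} ¬Pv with P? v
      ... | yes Pv = contradiction Pv ¬Pv
      ... | no _   = refl

      phases-cong : ∀ {P : Fin n → Set} (P? : ∀ v → Dec (P v)) {u v} →
                    (P u → P v) → (P v → P u) → phases P? u ≡ phases P? v
      phases-cong P? {u} {v} to from with P? u
      ... | yes Pu = sym (phases-yes P? (to Pu))
      ... | no ¬Pu = sym (phases-no P? (¬Pu ∘ from))

      phase-not⇒≢a : ∀ {v} (v∈Vc : v ∈ Vc) → phase v∈Vc ≡ not α → v ≢ a
      phase-not⇒≢a v∈Vc eq v≡a = not-¬ refl (trans (phase-irrelevant (sym v≡a) a∈Vc v∈Vc) eq)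

      -- Keeps `b` and `c` out of the shaded neighbourhood of `a`, since their phase differs from
      -- that of `a`.
      adj-a⇒phase≡α : ∀ {v} (v∈Vc : v ∈ Vc) → depth v ≡ 1 → phase v∈Vc ≡ α
      adj-a⇒phase≡α {v} v∈Vc dv with u , u~v , du ← parent v dv
        with refl ← depth≡0 (ℕₚ.suc-injective (trans du dv)) = sym (adj⇒phase≡ a∈Vc v∈Vc u~v)

      -- H is a set of vertices to be shaded ½, and P singles out the part of T beyond H as seen
      -- from a, where the proper colouring that agrees with b and c is used.
      module Cut {H P : Fin n → Set} (H? : ∀ v → Dec (H v)) (P? : ∀ v → Dec (P v))
                 (independent : ∀ {u v} → Adj T u v → H u → ¬ H v)
                 (P-down : ∀ {u v} → IsParent v u → ¬ H u → ¬ H v → P u → P v)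
                 (P-up   : ∀ {u v} → IsParent v u → ¬ H u → ¬ H v → P v → P u)
                 (a∉H : ¬ H a) (b∉H : ¬ H b) (c∉H : ¬ H c)
                 (¬Pa : ¬ P a) (Pb : P b) (Pc : P c) where

        χ : Fin n → Bool
        χ v = p v xor phases P? v

        -- `P` changes only at `H`, so along an unshaded edge the phase is constant and `p`
        -- alternates.
        χ-proper : ∀ {u v} → Adj T u v → ¬ H u → ¬ H v → χ u ≡ not (χ v)
        χ-proper {u} {v} u~v u∉H v∉H = xor-proper {phases P?} u~v (same (adj⇒parent u~v))
          where
          same : IsParent v u ⊎ IsParent u v → phases P? u ≡ phases P? v
          same (inj₁ v↑u) = phases-cong P? (P-down v↑u u∉H v∉H) (P-up v↑u u∉H v∉H)
          same (inj₂ u↑v) = phases-cong P? (P-up u↑v v∉H u∉H) (P-down u↑v v∉H u∉H)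

        ∉H×χ≡g : ∀ {u v} → v ≡ u → (u∈Vc : u ∈ Vc) → ¬ H u → phases P? u ≡ phase u∈Vc →
                 (v∈Vc : v ∈ Vc) → ¬ H v × χ v ≡ toBool (g v v∈Vc)
        ∉H×χ≡g {u} refl u∈Vc u∉H eq v∈Vc = u∉H ,
          trans (cong (p u xor_) (trans eq (phase-irrelevant refl u∈Vc v∈Vc))) (p-xor-phase v∈Vc)

        h : Fin n → ℝ
        h = shade H? χ

        h-compatible : ∀ {u v} → ¬ H u → ¬ H v → χ u ≡ not (χ v) → IsCompatibleGreyscale Vc g h
        h-compatible = shade-compatible H? χ λ v v∈Vc → cases v∈Vc (Vc⊆abc v v∈Vc)
          where
          cases : ∀ {v} (v∈Vc : v ∈ Vc) → v ≡ a ⊎ v ≡ b ⊎ v ≡ c → ¬ H v × χ v ≡ toBool (g v v∈Vc)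
          cases v∈Vc (inj₁ v≡a)        = ∉H×χ≡g v≡a a∈Vc a∉H (phases-no P? ¬Pa) v∈Vc
          cases v∈Vc (inj₂ (inj₁ v≡b)) =
            ∉H×χ≡g v≡b b∈Vc b∉H (trans (phases-yes P? Pb) (sym phase-b)) v∈Vc
          cases v∈Vc (inj₂ (inj₂ v≡c)) =
            ∉H×χ≡g v≡c c∈Vc c∉H (trans (phases-yes P? Pc) (sym phase-c)) v∈Vc

        ½≤contrast : ∀ {e} → e List.∈ es → ½ℝ ≤ contrast h e
        ½≤contrast e∈ = ½≤contrast-shade H? χ (independent u~v) (χ-proper u~v)
          where u~v = ∈-edges⇒Adj T e∈

        1≤contrast : ∀ {u v} → Adj T u v → ¬ H u → ¬ H v → 1ℝ ≤ contrast h (u , v)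
        1≤contrast u~v u∉H v∉H = 1≤contrast-shade H? χ u∉H v∉H (χ-proper u~v u∉H v∉H)

      -- Comparison with the greyscale that shades exactly the neighbours of a with ½.
      ½≤f : ∀ {e} → e List.∈ es → ½ℝ ≤ contrast f e
      ½≤f = contrast-lowerBound f-max (compatible′ (depth b) refl) ½ℝ ½≤contrast
        where
        independent : ∀ {u v} → Adj T u v → depth u ≡ 1 → depth v ≢ 1
        independent u~v du dv with adj⇒parent u~v
        ... | inj₁ (_ , eq) = ℕₚ.1+n≢n (trans eq (trans dv (sym du)))
        ... | inj₂ (_ , eq) = ℕₚ.1+n≢n (trans eq (trans du (sym dv)))
        depth≢1 : ∀ {v} (v∈Vc : v ∈ Vc) → phase v∈Vc ≡ not α → depth v ≢ 1
        depth≢1 v∈Vc eq dv = not-¬ (adj-a⇒phase≡α v∈Vc dv) eq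
        -- Once the neighbours of `a` are shaded, `a` is isolated, and all other vertices may take
        -- the opposite phase.
        ≢a? : ∀ v → Dec (v ≢ a)
        ≢a? v = ¬? (v Finₚ.≟ a)
        b≢a : b ≢ a
        b≢a = phase-not⇒≢a b∈Vc phase-b
        a∉H : depth a ≢ 1
        a∉H da≡1 = ℕₚ.1+n≢0 (trans (sym da≡1) depth-root)
        child≢a : ∀ {u v} → IsParent v u → v ≢ a
        child≢a (_ , eq) refl = ℕₚ.1+n≢0 (trans eq depth-root)
        open Cut (λ v → depth v ℕₚ.≟ 1) ≢a? independent
          (λ v↑u _ _ _ → child≢a v↑u)
          (λ (_ , eq) _ dv≢1 _ u≡a →
            dv≢1 (trans (sym eq) (cong suc (trans (cong depth u≡a) depth-root))))
          a∉H (depth≢1 b∈Vc phase-b) (depth≢1 c∈Vc phase-c)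
          (_$ refl) b≢a (phase-not⇒≢a c∈Vc phase-c)
        -- Two unshaded vertices of opposite colours are needed. At depth 2 the parent of `b` is
        -- shaded, but `b` and `a` have the same `p` and opposite phases; at depth 3 or more `b` and
        -- its parent serve.
        compatible′ : ∀ k → depth b ≡ k → IsCompatibleGreyscale Vc g h
        compatible′ 0 db = contradiction (depth≡0 db) b≢a
        compatible′ 1 db = contradiction db (depth≢1 b∈Vc phase-b)
        compatible′ 2 db with u , u~b , du ← parent b db
                         with du≡1 ← ℕₚ.suc-injective (trans du db)
                         with v , v~u , dv ← parent u du≡1
                         with refl ← depth≡0 (ℕₚ.suc-injective (trans dv du≡1)) =
          h-compatible (depth≢1 b∈Vc phase-b) a∉H (begin
            p b xor phases ≢a? b         ≡⟨ cong₂ _xor_ pb≡pa (phases-yes ≢a? b≢a) ⟩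
            p a xor not α                ≡⟨ not-distribʳ-xor (p a) α ⟨
            not (p a xor α)              ≡⟨ cong (λ t → not (p a xor t)) (phases-no ≢a? (_$ refl)) ⟨
            not (p a xor phases ≢a? a)   ∎)
          where
          open ≡-Reasoning
          pb≡pa : p b ≡ p a
          pb≡pa = begin
            p b             ≡⟨ p-proper (Graph.adj-sym T u~b) ⟩
            not (p u)       ≡⟨ cong not (p-proper (Graph.adj-sym T v~u)) ⟩
            not (not (p a)) ≡⟨ not-involutive (p a) ⟩
            p a             ∎
        compatible′ (suc (suc (suc k))) db with u , u~b , du ← parent b db =
          h-compatible u∉H (depth≢1 b∈Vc phase-b) (χ-proper u~b u∉H (depth≢1 b∈Vc phase-b))
          where
          u∉H : depth u ≢ 1
          u∉H du≡1 with () ← trans (sym db) (trans (sym du) (cong suc du≡1))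

      -- Two adjacent ½-vertices would give an edge of contrast 0, against `½≤f`.
      ½-independent : ∀ {u v} → Adj T u v → f u ≈ ½ℝ → ¬ f v ≈ ½ℝ
      ½-independent {u} {v} u~v fu≈½ fv≈½ =
        [ (λ ½≤ → ½≤ (abs-sub-½-½ (f u) (f v) fu≈½ fv≈½))
        , (λ ½≤ → ½≤ (abs-sub-½-½ (f v) (f u) fv≈½ fu≈½)) ]′
        (edge-with u~v (λ e → ½ℝ ≤ contrast f e) ½≤f)

      -- Two values in [0,1] strictly on the same side of ½ differ by less than ½.
      sides-alternate : ∀ {u v} β γ → Adj T u v → Side β (f u) → Side γ (f v) → γ ≡ not β
      sides-alternate {u} {v} β γ u~v fu fv = ¬-not λ γ≡β →
        let fv′ = subst (λ γ → Side γ (f v)) γ≡β fv in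
        [ (λ ½≤ → ½≤ (abs-sub-<½ β (f u) (f v) (f-InUnit u) (f-InUnit v) fu fv′))
        , (λ ½≤ → ½≤ (abs-sub-<½ β (f v) (f u) (f-InUnit v) (f-InUnit u) fv′ fu)) ]′
        (edge-with u~v (λ e → ½ℝ ≤ contrast f e) ½≤f)

      ½-Ancestor : Fin n → Set
      ½-Ancestor v = ∃[ h ] (Star IsParent v h × f h ≈ ½ℝ)

      -- Descends from `a`: until a ½-vertex is met, the side of `f` alternates along the path just
      -- as `p` does, starting from the prescribed colour of `a`.
      ½-ancestor-or-side : (∀ v → f v ≈ ½ℝ ⊎ ∃[ β ] Side β (f v)) →
                           ∀ k v → depth v ≡ k → ½-Ancestor v ⊎ Side (p v xor α) (f v)
      ½-ancestor-or-side side zero v dv with refl ← depth≡0 dv =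
        inj₂ (≈bool⇒Side (p a xor α) (f a)
          (subst (λ β → f a ≈ bool β) (sym (p-xor-phase a∈Vc)) (f≈g a a∈Vc)))
      ½-ancestor-or-side side (suc k) v dv with side v
      ... | inj₁ fv≈½ = inj₁ (v , Star.ε , fv≈½)
      ... | inj₂ (β , fv) with u , v↑u@(u~v , du) ← parent v dv
          with ½-ancestor-or-side side k u (ℕₚ.suc-injective (trans du dv))
      ...   | inj₁ (h , u⇝h , fh≈½) = inj₁ (h , v↑u ◅ u⇝h , fh≈½)
      ...   | inj₂ fu = inj₂ (subst (λ β → Side β (f v))
                (trans (sides-alternate (p u xor α) β u~v fu fv)
                  (sym (not-xor (p-proper (Graph.adj-sym T u~v)) α))) fv)

      -- Without a ½-vertex on the path, `f` would be on the side given by phase α, while the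
      -- prescribed colour is on the other.
      ½-ancestor : (∀ v → f v ≈ ½ℝ ⊎ ∃[ β ] Side β (f v)) →
                   ∀ {v} (v∈Vc : v ∈ Vc) → phase v∈Vc ≡ not α → ½-Ancestor v
      ½-ancestor side {v} v∈Vc eq with ½-ancestor-or-side side (depth v) v refl
      ... | inj₁ v⇝h = v⇝h
      ... | inj₂ fv  = contradiction
        (Side-unique (p v xor α) (toBool (g v v∈Vc)) (f v) fv
          (≈bool⇒Side (toBool (g v v∈Vc)) (f v) (f≈g v v∈Vc)))
        (not-¬ refl ∘ λ e → trans e (trans (sym (p-xor-phase v∈Vc))
          (trans (cong (p v xor_) eq) (sym (not-distribʳ-xor (p v) α)))))

      module _ {h₁ h₂} (b⇝h₁ : Star IsParent b h₁) (c⇝h₂ : Star IsParent c h₂)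
               (fh₁≈½ : f h₁ ≈ ½ℝ) (fh₂≈½ : f h₂ ≈ ½ℝ) where

        H : Fin n → Set
        H v = v ≡ h₁ ⊎ v ≡ h₂

        H? : ∀ v → Dec (H v)
        H? v = (v Finₚ.≟ h₁) ⊎-dec (v Finₚ.≟ h₂)

        H⇒½ : ∀ {v} → H v → f v ≈ ½ℝ
        H⇒½ (inj₁ refl) = fh₁≈½
        H⇒½ (inj₂ refl) = fh₂≈½

        -- The complement of the component of `a` in T - {h₁, h₂}.
        Beyond : Fin n → Set
        Beyond v = ∃[ h ] (H h × Star IsParent v h)

        -- The decision of `Beyond` is an argument because the caller, having a decidable goal, can
        -- obtain it under double negation.
        ½-inside-cut : (∀ v → Dec (Beyond v)) → ∀ (S : Subset n) → (∀ v → v ∈ S → f v ≈ ½ℝ) →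
                    ∀ w → w ∈ S → H w
        ½-inside-cut Beyond? S S-½ w w∈S = decidable-stable (H? w) λ w∉H → absurd w∉H (S-½ w w∈S)
          where
          independent : ∀ {u v} → Adj T u v → H u → ¬ H v
          independent u~v u∈H v∈H = ½-independent u~v (H⇒½ u∈H) (H⇒½ v∈H)
          -- The parent is unique, so a chain of ancestors from `v` to `H` goes through `u` unless
          -- `v` itself is in `H`.
          beyond-up : ∀ {u v} → IsParent v u → ¬ H u → ¬ H v → Beyond v → Beyond u
          beyond-up _ _ v∉H (_ , v∈H , Star.ε) = contradiction v∈H v∉H
          beyond-up v↑u _ _ (h , h∈H , v↑w ◅ w⇝h) with refl ← parent-unique v↑u v↑w = h , h∈H , w⇝h
          ∉H : ∀ {v} → v ∈ Vc → ¬ H v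
          ∉H v∈Vc v∈H = f-½⇒∉Vc (H⇒½ v∈H) v∈Vc
          ¬beyond-a : ¬ Beyond a
          ¬beyond-a (_ , a∈H , Star.ε) = ∉H a∈Vc a∈H
          ¬beyond-a (_ , _ , (_ , eq) ◅ _) = ℕₚ.1+n≢0 (trans eq depth-root)
          open Cut H? Beyond? independent
            (λ v↑u _ _ (h , h∈H , u⇝h) → h , h∈H , v↑u ◅ u⇝h) beyond-up
            (∉H a∈Vc) (∉H b∈Vc) (∉H c∈Vc) ¬beyond-a (h₁ , inj₁ refl , b⇝h₁) (h₂ , inj₂ refl , c⇝h₂)
          -- On an edge meeting `H`, ½ separates the two contrasts; on every other edge `h` attains
          -- 1.
          f≤h : ∀ {e} → e List.∈ es → contrast f e ≤ contrast h e
          f≤h {u , v} e∈ with H? u | H? v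
          ... | yes u∈H | _ = ≤-trans (contrast f (u , v)) ½ℝ (contrast h (u , v))
                                (contrast-½ (inj₁ (H⇒½ u∈H))) (½≤contrast e∈)
          ... | no _ | yes v∈H = ≤-trans (contrast f (u , v)) ½ℝ (contrast h (u , v))
                                (contrast-½ (inj₂ (H⇒½ v∈H))) (½≤contrast e∈)
          ... | no u∉H | no v∉H = ≤-trans (contrast f (u , v)) 1ℝ (contrast h (u , v))
                                (abs-sub-≤1 (f u) (f v) (f-InUnit u) (f-InUnit v))
                                (1≤contrast (∈-edges⇒Adj T e∈) u∉H v∉H)
          absurd : ¬ H w → ¬ f w ≈ ½ℝ
          absurd w∉H fw≈½ with depth w in dw
          ... | zero  = f-½⇒∉Vc fw≈½ (subst (_∈ Vc) (sym (depth≡0 dw)) a∈Vc)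
          ... | suc _ with x , x~w , _ ← parent w dw =
            [ strict x~w x∉H w∉H (inj₂ fw≈½) , strict (Graph.adj-sym T x~w) w∉H x∉H (inj₁ fw≈½) ]′
            (edge-with x~w (λ e → contrast h e ≤ contrast f e)
              (contrast-notDominated f-max (h-compatible x∉H w∉H (χ-proper x~w x∉H w∉H)) f≤h))
            where
            -- ½-vertices are independent, so the edge from `w` to its parent is unshaded: it shows
            -- that `h` attains both colours, and it is the strict edge.
            x∉H : ¬ H x
            x∉H x∈H = ½-independent x~w (H⇒½ x∈H) fw≈½
            strict : ∀ {u v} → Adj T u v → ¬ H u → ¬ H v → f u ≈ ½ℝ ⊎ f v ≈ ½ℝ →
                     ¬ contrast h (u , v) ≤ contrast f (u , v)
            strict {u} {v} u~v u∉H v∉H ½-end h≤f = h≤f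
              (≤-<-trans (contrast f (u , v)) ½ℝ (contrast h (u , v)) (contrast-½ ½-end)
                (<-≤-trans ½ℝ 1ℝ (contrast h (u , v)) ½<1 (1≤contrast u~v u∉H v∉H)))

    inconsistent⇒∣½∣≤2 : CardAtMost 2 (λ v → f v ≈ ½ℝ)
    inconsistent⇒∣½∣≤2 S S-½ = decidable-stable (∣ S ∣ ℕₚ.≤? 2) λ ∣S∣≰2 →
      ¬¬-∀ (¬¬-side ∘ f) λ side →
      let (h₁ , b⇝h₁ , fh₁≈½) = ½-ancestor side b∈Vc phase-b
          (h₂ , c⇝h₂ , fh₂≈½) = ½-ancestor side c∈Vc phase-c in
      ¬¬-∀ {P = λ v → Dec (Beyond b⇝h₁ c⇝h₂ fh₁≈½ fh₂≈½ v)} (λ v → ¬¬-excluded-middle) λ Beyond? →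
      ∣S∣≰2 (covered⇒∣S∣≤2 h₁ h₂ (½-inside-cut b⇝h₁ c⇝h₂ fh₁≈½ fh₂≈½ Beyond? S S-½))

  -- Two phases for three vertices: either all agree, or exactly one is out of phase, and that one
  -- is moved into the role of `a`.
  ∣½∣≤2 : ∣ Vc ∣ ≡ 3 → CardAtMost 2 (λ v → f v ≈ ½ℝ)
  ∣½∣≤2 ∣Vc∣≡3 with a , b , c , a∈Vc , b∈Vc , c∈Vc , Vc⊆abc ← ∣p∣≡3⇒elements Vc ∣Vc∣≡3
    with phase b∈Vc Bool.≟ phase a∈Vc | phase c∈Vc Bool.≟ phase a∈Vc
  ... | yes b≡a | yes c≡a = consistent⇒∣½∣≤2 a∈Vc λ {v} v∈Vc → cases v∈Vc (Vc⊆abc v v∈Vc)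
    where
    cases : ∀ {v} (v∈Vc : v ∈ Vc) → v ≡ a ⊎ v ≡ b ⊎ v ≡ c → phase v∈Vc ≡ phase a∈Vc
    cases v∈Vc (inj₁ v≡a)        = phase-irrelevant v≡a v∈Vc a∈Vc
    cases v∈Vc (inj₂ (inj₁ v≡b)) = trans (phase-irrelevant v≡b v∈Vc b∈Vc) b≡a
    cases v∈Vc (inj₂ (inj₂ v≡c)) = trans (phase-irrelevant v≡c v∈Vc c∈Vc) c≡a
  ... | no b≢a | no c≢a =
    inconsistent⇒∣½∣≤2 a∈Vc b∈Vc c∈Vc Vc⊆abc (¬-not b≢a) (¬-not c≢a)
  ... | no b≢a | yes c≡a =
    inconsistent⇒∣½∣≤2 b∈Vc a∈Vc c∈Vc (λ v → bac ∘ Vc⊆abc v)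
      (¬-not (b≢a ∘ sym)) (¬-not λ c≡b → b≢a (trans (sym c≡b) c≡a))
    where
    bac : ∀ {v} → v ≡ a ⊎ v ≡ b ⊎ v ≡ c → v ≡ b ⊎ v ≡ a ⊎ v ≡ c
    bac = [ inj₂ ∘ inj₁ , [ inj₁ , inj₂ ∘ inj₂ ]′ ]′
  ... | yes b≡a | no c≢a =
    inconsistent⇒∣½∣≤2 c∈Vc b∈Vc a∈Vc (λ v → cba ∘ Vc⊆abc v)
      (¬-not λ b≡c → c≢a (trans (sym b≡c) b≡a)) (¬-not (c≢a ∘ sym))
    where
    cba : ∀ {v} → v ≡ a ⊎ v ≡ b ⊎ v ≡ c → v ≡ c ⊎ v ≡ b ⊎ v ≡ a
    cba = [ inj₂ ∘ inj₂ , [ inj₂ ∘ inj₁ , inj₁ ]′ ]′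

theorem5p8 : ∀ {n : ℕ} (T : Graph n) → IsTree T →
    ∀ (Vc : Subset n) → Vc ⊂ ⊤ → ∣ Vc ∣ ≡ 3 →
    ∀ (g : Colouring Vc) →
    (∀ u v (u∈Vc : u ∈ Vc) (v∈Vc : v ∈ Vc) → Adj T u v → g u u∈Vc ≢ g v v∈Vc) →
    ∀ (f : Fin n → ℝ) → IsMaximumContrastGreyscale T Vc g f →
    CardAtMost 2 (λ v → f v ≈ ½ℝ)
theorem5p8 T T-tree Vc _ ∣Vc∣≡3 g g-proper f f-max
  -- A vertex is needed as root for the proper colouring by parity of depth; `Vc` supplies one.
  with a , _ ← ∣p∣≡3⇒elements Vc ∣Vc∣≡3 =
  ∣½∣≤2 T-tree g-proper f-max (parity-proper (rooting T T-tree a)) ∣Vc∣≡3
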